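{- Let $\mathbb{K}$ be a field of characteristic zero and let $3\le n\le 5$. Put $X_i:=\sum_{j\neq i}x_{\{i,j\}}$ for $1\le i\le n$. Then the following $\binom n2$ homogeneous invariants form a system of parameters for $\mathcal{I}_n$: $$\sum_{1\le i<j\le n}x_{\{i,j\}}^{k}\quad\Bigl(2\le k\le\tbinom{n-1}{2}\Bigr),\qquad \sum_{i=1}^n X_i^{k}\quad(1\le k\le n).$$
   Context: Let $\mathbb{K}[x_{\{i,j\}}]$ be the polynomial ring in the $m=\binom n2$ variables indexed by the pairs $\{i,j\}$, $1\le i<j\le n$. The symmetric group $\mathfrak{S}_n$ acts on it by $\sigma\cdot x_{\{i,j\}}=x_{\{\sigma(i),\sigma(j)\}}$, and $\mathcal{I}_n:=\mathbb{K}[x_{\{i,j\}}]^{\mathfrak{S}_n}$. A system of parameters of $\mathcal{I}_n$ is a set of $m$ homogeneous invariants $\theta_1,\dots,\theta_m$ such that $\mathcal{I}_n$ is a finitely generated module over its subring $\mathbb{K}[\theta_1,\dots,\theta_m]$. -}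

module Defs where

open import Level using (Level; _⊔_)
open import Algebra.Apartness.Bundles using (HeytingField; HeytingCommutativeRing)
open import Algebra.Bundles using (CommutativeRing; Semiring)
import Algebra.Consequences.Setoid as Consequences
import Algebra.Definitions.RawSemiring as RawSemiringOps
open import Data.Fin.Base using (Fin; _<_)
open import Data.Fin.Permutation using (Permutation′; _⟨$⟩ʳ_)
open import Data.Fin.Properties using (_≟_; _<?_; <-cmp; <⇒≢)
open import Data.List.Base using (List; length; lookup; map; upTo; _++_; foldr)
open import Data.List.Relation.Unary.All using (All)
open import Data.Nat.Base using (ℕ; suc; _∸_) renaming (_+_ to _+ℕ_)
open import Data.Nat.Combinatorics using (_C_)
open import Data.Product.Base using (Σ-syntax; ∃-syntax; _×_; _,_)
open import Data.Vec.Base as Vec using (Vec)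
open import Function.Bundles using (Injection)
open import Function.Properties.Inverse using (↔⇒↣)
open import Relation.Binary.Bundles using (Setoid)
open import Relation.Binary.Definitions using (tri<; tri≈; tri>)
open import Relation.Binary.PropositionalEquality using (_≡_; _≢_)
open import Relation.Nullary.Decidable using (Dec; yes; no; ¬?; recompute)
open import Relation.Nullary.Negation using (contradiction)

private
  variable
    c ℓ₁ ℓ₂ : Level

fieldRing : HeytingField c ℓ₁ ℓ₂ → CommutativeRing c ℓ₁
fieldRing K =
  HeytingCommutativeRing.commutativeRing (HeytingField.heytingCommutativeRing K)

-- No positive multiple of 1 is zero.  "Nonzero" is expressed by the apartness of
-- the field, which is tight, hence classically the negation of _≈_.
CharacteristicZero : HeytingField c ℓ₁ ℓ₂ → Set ℓ₂
CharacteristicZero K = ∀ k → (suc k · 1#) # 0#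
  where
  open HeytingField K using (_#_; 0#; 1#)
  open RawSemiringOps (Semiring.rawSemiring (CommutativeRing.semiring (fieldRing K)))
    using () renaming (_×_ to _·_)

-- The polynomial ring R[x_v : v ∈ V], as the free commutative R-algebra on V:
-- ring expressions in coefficients and variables, modulo the least congruence
-- that satisfies the commutative ring laws and makes `con` a ring homomorphism.
module Polynomials (R : CommutativeRing c ℓ₁) where

  private module R = CommutativeRing R

  infixl 6 _+_
  infixl 7 _*_
  infix  8 -_
  infix  4 _≈_

  data Polynomial (V : Set) : Set c where
    con : R.Carrier → Polynomial V
    var : V → Polynomial V
    _+_ : Polynomial V → Polynomial V → Polynomial V
    _*_ : Polynomial V → Polynomial V → Polynomial V
    -_  : Polynomial V → Polynomial V

  private
    variable
      V W : Set
      p p′ q q′ r : Polynomial V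
      a b : R.Carrier

  data _≈_ {V : Set} : Polynomial V → Polynomial V → Set (c ⊔ ℓ₁) where
    ≈-refl  : p ≈ p
    ≈-sym   : p ≈ q → q ≈ p
    ≈-trans : p ≈ q → q ≈ r → p ≈ r

    +-cong : p ≈ p′ → q ≈ q′ → p + q ≈ p′ + q′
    *-cong : p ≈ p′ → q ≈ q′ → p * q ≈ p′ * q′
    neg-cong : p ≈ q → - p ≈ - q

    +-assoc     : ∀ p q r → (p + q) + r ≈ p + (q + r)
    +-comm      : ∀ p q → p + q ≈ q + p
    +-identityˡ : ∀ p → con R.0# + p ≈ p
    +-inverseˡ  : ∀ p → (- p) + p ≈ con R.0#
    *-assoc     : ∀ p q r → (p * q) * r ≈ p * (q * r)
    *-comm      : ∀ p q → p * q ≈ q * p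
    *-identityˡ : ∀ p → con R.1# * p ≈ p
    distribˡ    : ∀ p q r → p * (q + r) ≈ p * q + p * r

    con-cong : a R.≈ b → con a ≈ con b
    con-+    : ∀ a b → con (a R.+ b) ≈ con a + con b
    con-*    : ∀ a b → con (a R.* b) ≈ con a * con b

  polynomialRing : Set → CommutativeRing c (c ⊔ ℓ₁)
  polynomialRing V = record
    { Carrier = Polynomial V
    ; _≈_ = _≈_
    ; _+_ = _+_
    ; _*_ = _*_
    ; -_  = -_
    ; 0#  = con R.0#
    ; 1#  = con R.1#
    ; isCommutativeRing = record
      { isRing = record
        { +-isAbelianGroup = record
          { isGroup = record
            { isMonoid = record
              { isSemigroup = record
                { isMagma = record
                  { isEquivalence = Setoid.isEquivalence S
                  ; ∙-cong = +-cong
                  }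
                ; assoc = +-assoc
                }
              ; identity = comm∧idˡ⇒id +-comm +-identityˡ
              }
            ; inverse = comm∧invˡ⇒inv +-comm +-inverseˡ
            ; ⁻¹-cong = neg-cong
            }
          ; comm = +-comm
          }
        ; *-cong = *-cong
        ; *-assoc = *-assoc
        ; *-identity = comm∧idˡ⇒id *-comm *-identityˡ
        ; distrib = comm∧distrˡ⇒distr +-cong *-comm distribˡ
        }
      ; *-comm = *-comm
      }
    }
    where
    S : Setoid c (c ⊔ ℓ₁)
    S = record
      { Carrier = Polynomial V
      ; _≈_ = _≈_
      ; isEquivalence = record { refl = ≈-refl ; sym = ≈-sym ; trans = ≈-trans }
      }
    open Consequences S

  module _ {V : Set} where
    open RawSemiringOps (Semiring.rawSemiring (CommutativeRing.semiring (polynomialRing V))) public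
      using (sum; _^_)

  0ₚ 1ₚ : Polynomial V
  0ₚ = con R.0#
  1ₚ = con R.1#

  -- Substitution of polynomials for the variables.
  eval : (V → Polynomial W) → Polynomial V → Polynomial W
  eval ρ (con a) = con a
  eval ρ (var v) = ρ v
  eval ρ (p + q) = eval ρ p + eval ρ q
  eval ρ (p * q) = eval ρ p * eval ρ q
  eval ρ (- p)   = - eval ρ p

  monomial : ∀ {d} → Vec V d → Polynomial V
  monomial = Vec.foldr′ (λ v p → var v * p) 1ₚ

  -- An R-linear combination of monomials of degree d (so 0 is homogeneous of
  -- every degree).
  Homogeneous : ℕ → Polynomial V → Set (c ⊔ ℓ₁)
  Homogeneous {V} d p =
    Σ[ ts ∈ List (R.Carrier × Vec V d) ]
      p ≈ foldr (λ (a , vs) q → con a * monomial vs + q) 0ₚ ts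

  -- Membership in the subalgebra R[θ₁, …, θ_r]: being a polynomial in the θᵢ.
  _∈R[_] : Polynomial V → List (Polynomial V) → Set (c ⊔ ℓ₁)
  p ∈R[ θ ] = ∃[ P ] p ≈ eval {V = Fin (length θ)} (lookup θ) P

-- The unordered pair {i, j} of distinct elements, stored with i < j.
record Pair (n : ℕ) : Set where
  constructor mkPair
  field
    lo hi  : Fin n
    .lo<hi : lo < hi

⟅_,_⟆ : ∀ {n} (i j : Fin n) → i ≢ j → Pair n
⟅ i , j ⟆ i≢j with <-cmp i j
... | tri< i<j _ _ = mkPair i j i<j
... | tri≈ _ i≡j _ = contradiction i≡j i≢j
... | tri> _ _ j<i = mkPair j i j<i

module GraphInvariants (K : HeytingField c ℓ₁ ℓ₂) (n : ℕ) where

  open Polynomials (fieldRing K)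

  infixr 8 _∙ₑ_ _∙_

  _∙ₑ_ : Permutation′ n → Pair n → Pair n
  σ ∙ₑ mkPair i j i<j =
    ⟅ σ ⟨$⟩ʳ i , σ ⟨$⟩ʳ j ⟆
      (λ σi≡σj → <⇒≢ (recompute (i <? j) i<j) (Injection.injective (↔⇒↣ σ) σi≡σj))

  _∙_ : Permutation′ n → Polynomial (Pair n) → Polynomial (Pair n)
  σ ∙ p = eval (λ e → var (σ ∙ₑ e)) p

  -- Membership in ℐₙ.
  Invariant : Polynomial (Pair n) → Set (c ⊔ ℓ₁)
  Invariant p = ∀ σ → σ ∙ p ≈ p

  -- ℐₙ is a finitely generated K[θ]-module.
  FinitelyGeneratedOver : List (Polynomial (Pair n)) → Set (c ⊔ ℓ₁)
  FinitelyGeneratedOver θ =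
    ∃[ gs ] All Invariant gs ×
      (∀ f → Invariant f →
        Σ[ a ∈ (Fin (length gs) → Polynomial (Pair n)) ]
          (∀ k → a k ∈R[ θ ]) × f ≈ sum (λ k → a k * lookup gs k))

  record IsSystemOfParameters (θ : List (Polynomial (Pair n))) : Set (c ⊔ ℓ₁) where
    field
      size              : length θ ≡ n C 2
      homogeneous       : All (λ t → ∃[ d ] Homogeneous d t) θ
      invariant         : All Invariant θ
      finitelyGenerated : FinitelyGeneratedOver θ

  -- Restricts a sum to the indices satisfying a decidable condition.
  when : ∀ {a} {A : Set a} → Dec A → (A → Polynomial (Pair n)) → Polynomial (Pair n)
  when (yes a) f = f a
  when (no _)  f = 0ₚ

  X : Fin n → Polynomial (Pair n)
  X i = sum λ (j : Fin n) → when (¬? (i ≟ j)) λ i≢j → var (⟅ i , j ⟆ i≢j)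

  pairPowerSum : ℕ → Polynomial (Pair n)
  pairPowerSum k =
    sum λ (i : Fin n) → sum λ (j : Fin n) → when (i <? j) λ i<j → var (mkPair i j i<j) ^ k

  vertexPowerSum : ℕ → Polynomial (Pair n)
  vertexPowerSum k = sum λ i → X i ^ k

  -- The list a, a + 1, …, b, empty if b < a (as happens for [ 2 ⋯ 1 ] when n = 3).
  [_⋯_] : ℕ → ℕ → List ℕ
  [ a ⋯ b ] = map (a +ℕ_) (upTo (suc b ∸ a))

  parameters : List (Polynomial (Pair n))
  parameters = map pairPowerSum [ 2 ⋯ (n ∸ 1) C 2 ] ++ map vertexPowerSum [ 1 ⋯ n ]

{-# OPTIONS --safe #-}

-- If every variable is nilpotent modulo the ideal (θ), with θ homogeneous of positive degree,
-- then all monomials of large degree lie in (θ), and by induction on the degree K[x] is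
-- spanned over K[θ] by the monomials of small degree; averaging over the symmetric group
-- transfers this to the invariants.  So let Q be the quotient of K[x] by the radical of (θ), a
-- reduced ring without ℤ-torsion: it has to be shown that all x_e vanish in Q.
--
-- By Newton's identities, Σ X_i^k = 0 for k ≤ n gives X_i = 0.  For n = 3 these are enough
-- linear equations.  For n = 4 they say that opposite edges agree and that the three remaining
-- values have sum zero, and Newton's identities apply again.  For n = 5 the equations X_i = 0
-- cut out the representation (3,2) of 𝔖₅, which up to a sign is the standard representation of
-- 𝔖₆ restricted along the exotic embedding 𝔖₅ ⊂ 𝔖₆: there are six elements y of sum zero such
-- that the x_e are ±(y_a + y_b + y_c) for the ten splittings 3 + 3 of the six points.  The even
-- power sums of the x_e are symmetric in y, and p₂ = p₄ = p₆ = 0 amounts to e₂ = e₄ = 0 and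
-- 22 e₆ = e₃².  Explicit identities put e₅² and then e₃⁴ into the ideal of p₂, …, p₆, so that all
-- e_k(y) vanish, and y⁶ = 0.
module Submission where

open import Defs
open import Algebra.Apartness.Bundles using (HeytingField)
open import Algebra.Bundles using (CommutativeRing)
import Algebra.Properties.CommutativeMonoid.Mult as Mult
import Algebra.Properties.CommutativeSemigroup as CommutativeSemigroupProperties
import Algebra.Properties.CommutativeSemiring.Exp as Exp
import Algebra.Properties.Group as GroupProperties
import Algebra.Properties.Ring as RingProperties
import Algebra.Properties.Semiring.Mult as SemiringMult
import Algebra.Properties.Semiring.Sum as SemiringSum
import Algebra.Solver.Ring as RingSolver
open import Algebra.Solver.Ring.AlmostCommutativeRing
  using (fromCommutativeRing; _-Raw-AlmostCommutative⟶_)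
open import Data.Bool.Base using (Bool; true; false; _∨_; if_then_else_)
open import Data.Fin.Base as Fin using (Fin; zero; suc; toℕ)
open import Data.Fin.Patterns
open import Data.Fin.Permutation as Perm
  using (Permutation′; _⟨$⟩ʳ_; _∘ₚ_; insert; remove; insert-punchIn; punchIn-permute)
open import Data.Fin.Properties using (_≟_; _<?_; <-cmp; <-asym; <-irrefl; toℕ<n; toℕ-inject₁)
open import Data.Integer.Base as ℤ using (ℤ; -[1+_]; _⊖_; _◃_; +-*-rawRing)
import Data.Integer.Properties as ℤₚ
open import Data.List.Base as List using (List; []; _∷_; _++_; length; lookup)
open import Data.List.Membership.Propositional using (_∈_)
open import Data.List.Membership.Propositional.Properties
  using (∈-concatMap⁺; ∈-allFin; ∈-map⁺; ∈-upTo⁺; ∈-lookup; ∈-++⁺ˡ; ∈-++⁺ʳ)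
import Data.List.Properties as Listₚ
open import Data.List.Relation.Unary.All as All using (All; []; _∷_)
import Data.List.Relation.Unary.All.Properties as AllP
open import Data.List.Relation.Unary.Any as Any using (here; there)
open import Data.List.Relation.Unary.Any.Properties using (lookup-index)
open import Data.Maybe.Base using (Maybe; just; nothing; is-just)
open import Data.Nat.Base as ℕ using (ℕ; zero; suc; _≤_; _<_; z≤n; s≤s; _!)
open import Data.Nat.Combinatorics using (_C_)
open import Data.Nat.Induction using (<-rec)
import Data.Nat.Properties as ℕₚ
open import Data.Product.Base as Product using (∃-syntax; _,_; proj₁; proj₂)
open import Data.Sign.Base as Sign using (Sign)
open import Data.Sum.Base using (inj₁; inj₂)
open import Data.Unit.Base using (⊤; tt)
open import Data.Vec.Base as Vec using (Vec; []; _∷_)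
import Data.Vec.Functional as Vector
open import Data.Vec.Properties using (lookup∘tabulate)
open import Function.Base using (_∘_; const)
open import Function.Bundles using (Injection)
open import Function.Properties.Inverse using (↔⇒↣)
open import Level using (_⊔_)
open import Relation.Binary.Definitions using (tri<; tri≈; tri>)
open import Relation.Binary.PropositionalEquality as ≡ using (_≡_; _≢_)
import Relation.Binary.Reasoning.Setoid as SetoidReasoning
open import Relation.Nullary.Decidable using (Dec; yes; no; does; ¬?)
open import Relation.Nullary.Negation using (contradiction; contradiction-irr)

-- Ring identities with integer coefficients in an arbitrary commutative ring.

module IntegerCoefficients {c ℓ} (R : CommutativeRing c ℓ) where

  open import Data.Integer.Base using (+_)
  open CommutativeRing R
  open RingProperties ring
  open SemiringMult semiring
  open SetoidReasoning setoid

  -- The unique ring map from the integers. Equality in the ring need not be decidable, so the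
  -- solver takes its coefficients from ℤ, where normal forms can be compared.
  fromℤ : ℤ → Carrier
  fromℤ (+ n)    = n × 1#
  fromℤ -[1+ n ] = - (suc n × 1#)

  fromℤ-neg : ∀ i → fromℤ (ℤ.- i) ≈ - fromℤ i
  fromℤ-neg (+ zero)  = sym -0#≈0#
  fromℤ-neg (+ suc n) = refl
  fromℤ-neg -[1+ n ]  = sym (-‿involutive _)

  fromℤ-⊖ : ∀ m n → fromℤ (m ⊖ n) ≈ m × 1# - n × 1#
  fromℤ-⊖ m zero = sym (trans (+-congˡ -0#≈0#) (+-identityʳ _))
  fromℤ-⊖ zero (suc n) = sym (+-identityˡ _)
  fromℤ-⊖ (suc m) (suc n) = begin
    fromℤ (suc m ⊖ suc n)               ≡⟨ ≡.cong fromℤ (ℤₚ.[1+m]⊖[1+n]≡m⊖n m n) ⟩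
    fromℤ (m ⊖ n)                       ≈⟨ fromℤ-⊖ m n ⟩
    m × 1# - n × 1#                     ≈⟨ +-identityˡ _ ⟨
    0# + (m × 1# - n × 1#)              ≈⟨ +-congʳ (-‿inverseʳ 1#) ⟨
    (1# - 1#) + (m × 1# - n × 1#)       ≈⟨ interchange 1# (- 1#) (m × 1#) (- (n × 1#)) ⟩
    (1# + m × 1#) + (- 1# - n × 1#)     ≈⟨ +-congˡ (-‿+-comm 1# (n × 1#)) ⟩
    (1# + m × 1#) - (1# + n × 1#)       ∎
    where
    open CommutativeSemigroupProperties +-commutativeSemigroup using (interchange)

  fromℤ-+ : ∀ i j → fromℤ (i ℤ.+ j) ≈ fromℤ i + fromℤ j
  fromℤ-+ (+ m)    (+ n)    = ×-homo-+ 1# m n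
  fromℤ-+ (+ m)    -[1+ n ] = fromℤ-⊖ m (suc n)
  fromℤ-+ -[1+ m ] (+ n)    = trans (fromℤ-⊖ n (suc m)) (+-comm _ _)
  fromℤ-+ -[1+ m ] -[1+ n ] = begin
    - (suc (suc (m ℕ.+ n)) × 1#)       ≡⟨ ≡.cong (λ k → - (suc k × 1#)) (ℕₚ.+-suc m n) ⟨
    - ((suc m ℕ.+ suc n) × 1#)         ≈⟨ -‿cong (×-homo-+ 1# (suc m) (suc n)) ⟩
    - (suc m × 1# + suc n × 1#)        ≈⟨ -‿+-comm _ _ ⟨
    - (suc m × 1#) - (suc n × 1#)      ∎

  fromℤ-◃ : ∀ n → fromℤ (Sign.- ◃ n) ≈ - (n × 1#)
  fromℤ-◃ zero    = sym -0#≈0#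
  fromℤ-◃ (suc n) = refl

  fromℤ-* : ∀ i j → fromℤ (i ℤ.* j) ≈ fromℤ i * fromℤ j
  fromℤ-* (+ m)    (+ n)    = trans (reflexive (≡.cong fromℤ (ℤₚ.+◃n≡+n (m ℕ.* n)))) (×1-homo-* m n)
  fromℤ-* (+ m)    -[1+ n ] = begin
    fromℤ (Sign.- ◃ (m ℕ.* suc n))  ≈⟨ fromℤ-◃ (m ℕ.* suc n) ⟩
    - ((m ℕ.* suc n) × 1#)          ≈⟨ -‿cong (×1-homo-* m (suc n)) ⟩
    - (m × 1# * suc n × 1#)         ≈⟨ -‿distribʳ-* _ _ ⟩
    m × 1# * - (suc n × 1#)         ∎
  fromℤ-* -[1+ m ] (+ n)    = begin
    fromℤ (Sign.- ◃ (suc m ℕ.* n))  ≈⟨ fromℤ-◃ (suc m ℕ.* n) ⟩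
    - ((suc m ℕ.* n) × 1#)          ≈⟨ -‿cong (×1-homo-* (suc m) n) ⟩
    - (suc m × 1# * n × 1#)         ≈⟨ -‿distribˡ-* _ _ ⟩
    - (suc m × 1#) * n × 1#         ∎
  fromℤ-* -[1+ m ] -[1+ n ] = begin
    (suc m ℕ.* suc n) × 1#              ≈⟨ ×1-homo-* (suc m) (suc n) ⟩
    suc m × 1# * suc n × 1#             ≈⟨ -‿involutive _ ⟨
    - - (suc m × 1# * suc n × 1#)       ≈⟨ -‿cong (-‿distribˡ-* _ _) ⟩
    - (- (suc m × 1#) * suc n × 1#)     ≈⟨ -‿distribʳ-* _ _ ⟩
    - (suc m × 1#) * - (suc n × 1#)     ∎

  fromℤ-homo : +-*-rawRing -Raw-AlmostCommutative⟶ fromCommutativeRing R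
  fromℤ-homo = record
    { ⟦_⟧    = fromℤ
    ; +-homo = fromℤ-+
    ; *-homo = fromℤ-*
    ; -‿homo = fromℤ-neg
    ; 0-homo = refl
    ; 1-homo = +-identityʳ 1#
    }

  fromℤ-≟ : ∀ i j → Maybe (fromℤ i ≈ fromℤ j)
  fromℤ-≟ i j with i ℤₚ.≟ j
  ... | yes i≡j = just (reflexive (≡.cong fromℤ i≡j))
  ... | no  _   = nothing

  open RingSolver +-*-rawRing (fromCommutativeRing R) fromℤ-homo fromℤ-≟ public

  -- Proof by reflection: normal forms are syntactic and do not see `ρ`, so for closed polynomials
  -- the test computes and the hypothesis is `≡.refl`.
  by-normalisation : ∀ {n} (p q : Polynomial n) ρ →
    is-just (normalise p ≟N normalise q) ≡ true → ⟦ p ⟧ ρ ≈ ⟦ q ⟧ ρ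
  by-normalisation p q ρ eq with normalise p ≟N normalise q
  ... | just p≈q = begin
    ⟦ p ⟧ ρ              ≈⟨ correct p ρ ⟨
    ⟦ normalise p ⟧N ρ   ≈⟨ ⟦ p≈q ⟧N-cong ρ ⟩
    ⟦ normalise q ⟧N ρ   ≈⟨ correct q ρ ⟩
    ⟦ q ⟧ ρ              ∎

-- Enumeration of the edges, and edge weights in a commutative ring.

pairUp : ∀ {n} (j i : Fin n) → List (Pair n)
pairUp j i with i <? j
... | yes i<j = mkPair i j i<j ∷ []
... | no  _   = []

-- In colexicographic order: 01, 02, 12, 03, 13, 23, 04, …
pairs : ∀ n → List (Pair n)
pairs n = List.concatMap (λ j → List.concatMap (pairUp j) (List.allFin n)) (List.allFin n)

∈-pairUp : ∀ {n} (i j : Fin n) .(i<j : i Fin.< j) → mkPair i j i<j ∈ pairUp j i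
∈-pairUp i j i<j with i <? j
... | yes _   = here ≡.refl
... | no  i≮j = contradiction-irr i<j i≮j

∈-pairs : ∀ {n} (e : Pair n) → e ∈ pairs n
∈-pairs {n} (mkPair i j i<j) =
  ∈-concatMap⁺ _ (Any.map (λ { ≡.refl → ∈-concatMap⁺ (pairUp j)
    (Any.map (λ { ≡.refl → ∈-pairUp i j i<j }) (∈-allFin i)) }) (∈-allFin j))

-- The position in `pairs n` serves as the number of the solver variable attached to an edge.
edge : ∀ {n} → Pair n → Fin (List.length (pairs n))
edge e = Any.index (∈-pairs e)

module EdgeWeights {c ℓ} (R : CommutativeRing c ℓ) where

  open CommutativeRing R
  open SemiringSum semiring using (sum)
  open Exp commutativeSemiring using (_^_)

  when : ∀ {a} {A : Set a} → Dec A → (A → Carrier) → Carrier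
  when (yes a) f = f a
  when (no _)  f = 0#

  -- The sums of `GraphInvariants`, but over any commutative ring, so that they can be formed in the
  -- reduced quotient.
  vertexSum : ∀ {n} → (Pair n → Carrier) → Fin n → Carrier
  vertexSum x i = sum λ j → when (¬? (i ≟ j)) λ i≢j → x (⟅ i , j ⟆ i≢j)

  pairSum : ∀ {n} → (Pair n → Carrier) → ℕ → Carrier
  pairSum x k = sum λ i → sum λ j → when (i <? j) λ i<j → x (mkPair i j i<j) ^ k

module _ {c ℓ} (R : CommutativeRing c ℓ) where

  open CommutativeRing R
  open SemiringMult semiring
  open Exp commutativeSemiring

  TorsionFree : Set (c ⊔ ℓ)
  TorsionFree = ∀ d x → suc d × x ≈ 0# → x ≈ 0#

  Reduced : Set (c ⊔ ℓ)
  Reduced = ∀ k x → x ^ k ≈ 0# → x ≈ 0#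

-- Vanishing certificates in reduced torsion-free rings.

module ReducedTorsionFree {c ℓ} (R : CommutativeRing c ℓ)
  (torsionFree : TorsionFree R) (reduced : Reduced R) where

  open import Data.Integer.Base using (+_)
  open CommutativeRing R
  open SemiringMult semiring
  open Exp commutativeSemiring
  open SemiringSum semiring
  open IntegerCoefficients R
  open EdgeWeights R
  open SetoidReasoning setoid

  Σₚ : ∀ {m} → List (Polynomial m) → Polynomial m
  Σₚ = List.foldr _:+_ (con (+ 0))

  int : ∀ {m} → ℕ → Polynomial m
  int n = con (+ n)

  -int : ∀ {m} → ℕ → Polynomial m
  -int n = con (ℤ.- (+ n))

  -- A list of cofactors `a` and relations `p`, standing for the ideal element Σ a p. Only the
  -- relations have to vanish; cofactors are arbitrary.
  Certificate : ℕ → Set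
  Certificate m = List (Polynomial m Product.× Polynomial m)

  combination : ∀ {m} → Certificate m → Polynomial m
  combination = Σₚ ∘ List.map (λ (a , p) → a :* p)

  Vanishing : ∀ {m} → Vec Carrier m → Certificate m → Set _
  Vanishing ρ = All (λ (_ , p) → ⟦ p ⟧ ρ ≈ 0#)

  combination≈0 : ∀ {m} ρ (cs : Certificate m) → Vanishing ρ cs →
    ⟦ combination cs ⟧ ρ ≈ 0#
  combination≈0 ρ []             []         = refl
  combination≈0 ρ ((a , p) ∷ cs) (p≈0 ∷ hs) = begin
    ⟦ a ⟧ ρ * ⟦ p ⟧ ρ + ⟦ combination cs ⟧ ρ  ≈⟨ +-cong (*-congˡ p≈0) (combination≈0 ρ cs hs) ⟩
    ⟦ a ⟧ ρ * 0# + 0#                         ≈⟨ +-identityʳ _ ⟩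
    ⟦ a ⟧ ρ * 0#                              ≈⟨ zeroʳ _ ⟩
    0#                                        ∎

  -- A polynomial identity (d + 1) t^k = Σ a p over ℤ forces t to vanish where all p do:
  -- torsion-freeness cancels d + 1 and reducedness removes the exponent. The numeral passed as `d`
  -- is one less than the factor.
  vanish : ∀ {m} d (t : Polynomial m) k cs ρ → Vanishing ρ cs →
    is-just (normalise (int (suc d) :* t :^ k) ≟N normalise (combination cs)) ≡ true →
    ⟦ t ⟧ ρ ≈ 0#
  vanish d t k cs ρ hs eq = reduced k _ (torsionFree d _ (begin
    suc d × ⟦ t ⟧ ρ ^ k             ≈⟨ ×-congʳ (suc d) (*-identityˡ _) ⟨
    suc d × (1# * ⟦ t ⟧ ρ ^ k)      ≈⟨ ×-assoc-* (suc d) 1# _ ⟨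
    (suc d × 1#) * ⟦ t ⟧ ρ ^ k      ≈⟨ by-normalisation (int (suc d) :* t :^ k) (combination cs) ρ eq ⟩
    ⟦ combination cs ⟧ ρ            ≈⟨ combination≈0 ρ cs hs ⟩
    0#                              ∎))

  -- Elementary symmetric polynomials and Newton's identities.

  esym : ∀ {m} → ℕ → List (Polynomial m) → Polynomial m
  esym zero    _        = int 1
  esym (suc k) []       = int 0
  esym (suc k) (x ∷ xs) = x :* esym k xs :+ esym (suc k) xs

  powerSum : ∀ m → ℕ → Polynomial m
  powerSum m k = Σₚ (List.tabulate {n = m} λ i → var i :^ k)

  vars : ∀ m → List (Polynomial m)
  vars m = List.tabulate var

  ⟦Σₚ⟧ : ∀ {m n} (p : Fin n → Polynomial m) ρ → ⟦ Σₚ (List.tabulate p) ⟧ ρ ≈ sum (λ i → ⟦ p i ⟧ ρ)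
  ⟦Σₚ⟧ {n = zero}  p ρ = refl
  ⟦Σₚ⟧ {n = suc n} p ρ = +-congˡ (⟦Σₚ⟧ (p ∘ suc) ρ)

  -- Let n = m + 1 be the number of variables and X the first one.  Newton's identities express
  -- the e_k in X^n − e₁ X^(n-1) + … ± e_n = 0 through the power sums; the coefficient of p_i in
  -- n! X^n is Σ_{k ≥ i} (-1)^(k-i) (n! / k) X^(n-k) e_{k-i}.  Here i : Fin n stands for p_{i+1}.
  newtonTerm : ∀ m → Fin (suc m) → Polynomial (suc m) Product.× Polynomial (suc m)
  newtonTerm m i =
    Σₚ (List.map (λ j → con ((ℤ.- (+ 1)) ℤ.^ j ℤ.* (+ (suc m ! ℕ./ suc (toℕ i ℕ.+ j)))) :*
                        var 0F :^ (m ℕ.∸ (toℕ i ℕ.+ j)) :* esym j (vars (suc m)))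
                 (List.upTo (suc m ℕ.∸ toℕ i))) ,
    powerSum (suc m) (suc (toℕ i))

  newtonCertificate : ∀ m → Certificate (suc m)
  newtonCertificate m = List.tabulate (newtonTerm m)

  head≈0 : ∀ m → m ≤ 4 → (x : Fin (suc m) → Carrier) →
    (∀ (k : Fin (suc m)) → sum (λ i → x i ^ suc (toℕ k)) ≈ 0#) → x 0F ≈ 0#
  head≈0 m m≤4 x h = go m m≤4 x hs
    where
    hs : Vanishing (Vec.tabulate x) (newtonCertificate m)
    hs = AllP.tabulate⁺ {f = newtonTerm m} λ k → trans (⟦Σₚ⟧ {n = suc m} (λ i → var i :^ suc (toℕ k)) (Vec.tabulate x))
                         (trans (sum-cong-≋ (λ i → ^-congˡ (suc (toℕ k)) (reflexive (lookup∘tabulate x i)))) (h k))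
    go : ∀ m → m ≤ 4 → (x : Fin (suc m) → Carrier) →
         Vanishing (Vec.tabulate x) (newtonCertificate m) → x 0F ≈ 0#
    -- The factor is (m + 1)! and the exponent is the number of variables m + 1. Each m is treated
    -- separately because normalisation computes only for a closed number of variables.
    go 0 _ x hs = vanish 0 (var 0F) 1 (newtonCertificate 0) (Vec.tabulate x) hs ≡.refl
    go 1 _ x hs = vanish 1 (var 0F) 2 (newtonCertificate 1) (Vec.tabulate x) hs ≡.refl
    go 2 _ x hs = vanish 5 (var 0F) 3 (newtonCertificate 2) (Vec.tabulate x) hs ≡.refl
    go 3 _ x hs = vanish 23 (var 0F) 4 (newtonCertificate 3) (Vec.tabulate x) hs ≡.refl
    go 4 _ x hs = vanish 119 (var 0F) 5 (newtonCertificate 4) (Vec.tabulate x) hs ≡.refl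
    go (suc (suc (suc (suc (suc _))))) (s≤s (s≤s (s≤s (s≤s ())))) x hs

  -- Once the first value is known to vanish, it drops out of every power sum, and the exponents 1
  -- to m, reached through `inject₁`, suffice for the m remaining values.
  powerSums≈0⇒≈0 : ∀ m → m ≤ 5 → (x : Fin m → Carrier) →
    (∀ (k : Fin m) → sum (λ i → x i ^ suc (toℕ k)) ≈ 0#) → ∀ i → x i ≈ 0#
  powerSums≈0⇒≈0 (suc m) (s≤s m≤4) x h = λ where
      zero    → x₀≈0
      (suc i) → powerSums≈0⇒≈0 m (ℕₚ.≤-trans m≤4 (ℕₚ.n≤1+n 4)) (x ∘ suc) tail i
    where
    x₀≈0 : x 0F ≈ 0#
    x₀≈0 = head≈0 m m≤4 x h
    tail : ∀ (k : Fin m) → sum (λ i → x (suc i) ^ suc (toℕ k)) ≈ 0#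
    tail k = begin
      sum (λ i → x (suc i) ^ suc (toℕ k))      ≈⟨ +-identityˡ _ ⟨
      0# + sum (λ i → x (suc i) ^ suc (toℕ k)) ≈⟨ +-congʳ (trans (*-congʳ x₀≈0) (zeroˡ _)) ⟨
      sum (λ i → x i ^ suc (toℕ k))            ≡⟨ ≡.cong (λ j → sum (λ i → x i ^ suc j)) (toℕ-inject₁ k) ⟨
      sum (λ i → x i ^ suc (toℕ (Fin.inject₁ k))) ≈⟨ h (Fin.inject₁ k) ⟩
      0# ∎

  -- Edge weights as solver variables.

  whenₚ : ∀ {a m} {A : Set a} → Dec A → (A → Polynomial m) → Polynomial m
  whenₚ (yes a) p = p a
  whenₚ (no _)  _ = int 0

  sumₚ : ∀ {m n} → (Fin n → Polynomial m) → Polynomial m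
  sumₚ = Vector.foldr _:+_ (int 0)

  module _ (n : ℕ) where

    size : ℕ
    size = List.length (pairs n)

    values : (Pair n → Carrier) → Vec Carrier size
    values x = Vec.tabulate (x ∘ List.lookup (pairs n))

    edgeVar : Pair n → Polynomial size
    edgeVar e = var (edge e)

    -- For closed n, evaluating this at `values x` reduces to `vertexSum x`, and likewise `pairSumₚ`
    -- to `pairSum x`; hypotheses on sums can thus be handed to `vanish` unchanged.
    X : Fin n → Polynomial size
    X i = sumₚ λ j → whenₚ (¬? (i ≟ j)) λ i≢j → edgeVar (⟅ i , j ⟆ i≢j)

    pairSumₚ : ℕ → Polynomial size
    pairSumₚ k = sumₚ λ i → sumₚ λ j → whenₚ (i <? j) λ i<j → edgeVar (mkPair i j i<j) :^ k

    fromValues : ∀ x → (∀ v → ⟦ var v ⟧ (values x) ≈ 0#) → ∀ e → x e ≈ 0#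
    fromValues x h e = begin
      x e                                       ≡⟨ ≡.cong x (lookup-index (∈-pairs e)) ⟩
      x (List.lookup (pairs n) (edge e))        ≡⟨ lookup∘tabulate (x ∘ List.lookup (pairs n)) (edge e) ⟨
      Vec.lookup (values x) (edge e)            ≈⟨ h (edge e) ⟩
      0#                                        ∎

  -- Three vertices.

  module _ (x : Pair 3 → Carrier) (X≈0 : ∀ i → vertexSum x i ≈ 0#) where

    -- If i, j, k are the three vertices, then X_i + X_j - X_k is twice the weight of the edge ij.
    edgeWeights≈0₃ : ∀ e → x e ≈ 0#
    edgeWeights≈0₃ = fromValues 3 x λ where
        0F → go 0F (int 1) (int 1) (-int 1) ≡.refl
        1F → go 1F (int 1) (-int 1) (int 1) ≡.refl
        2F → go 2F (-int 1) (int 1) (int 1) ≡.refl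
      where
      go : ∀ v a b c → _ → _
      go v a b c = vanish 1 (var v) 1 ((a , X 3 0F) ∷ (b , X 3 1F) ∷ (c , X 3 2F) ∷ []) (values 3 x)
        (X≈0 0F ∷ X≈0 1F ∷ X≈0 2F ∷ [])

  -- Four vertices.

  module _ (x : Pair 4 → Carrier) (X≈0 : ∀ i → vertexSum x i ≈ 0#)
    (p≈0 : ∀ (k : Fin 2) → pairSum x (2 ℕ.+ toℕ k) ≈ 0#) where

    private
      ρ = values 4 x

      -- Opposite edges of K₄ share a letter.
      a₁ a₂ b₁ b₂ c₁ c₂ : Polynomial 6
      a₁ = var 0F
      b₁ = var 1F
      c₁ = var 2F
      c₂ = var 3F
      b₂ = var 4F
      a₂ = var 5F

      -- For opposite edges ij and kl, X_k + X_l - X_i - X_j is twice the difference of the weights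
      -- of kl and ij.
      difference : ∀ p q r s t → _ → ⟦ p ⟧ ρ ≈ 0#
      difference p q r s t = vanish 1 p 1
        ((q , X 4 0F) ∷ (r , X 4 1F) ∷ (s , X 4 2F) ∷ (t , X 4 3F) ∷ []) ρ
        (X≈0 0F ∷ X≈0 1F ∷ X≈0 2F ∷ X≈0 3F ∷ [])

      a₂-a₁ : ⟦ a₂ :- a₁ ⟧ ρ ≈ 0#
      a₂-a₁ = difference (a₂ :- a₁) (-int 1) (-int 1) (int 1) (int 1) ≡.refl

      b₂-b₁ : ⟦ b₂ :- b₁ ⟧ ρ ≈ 0#
      b₂-b₁ = difference (b₂ :- b₁) (-int 1) (int 1) (-int 1) (int 1) ≡.refl

      c₂-c₁ : ⟦ c₂ :- c₁ ⟧ ρ ≈ 0#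
      c₂-c₁ = difference (c₂ :- c₁) (int 1) (-int 1) (-int 1) (int 1) ≡.refl

      abc : Fin 3 → Polynomial 6
      abc 0F = a₁
      abc 1F = b₁
      abc 2F = c₁

      abc≈0 : ∀ i → ⟦ abc i ⟧ ρ ≈ 0#
      abc≈0 = powerSums≈0⇒≈0 3 (s≤s (s≤s (s≤s z≤n))) (λ i → ⟦ abc i ⟧ ρ) λ where
          -- The first power sum of a₁, b₁, c₁ is X_0 with c₂ replaced by c₁. The second and third
          -- are half of the edge power sums, each edge being exchanged for its opposite by
          -- factoring s^k - t^k through s - t.
          0F → vanish 0 (power 1) 1 ((int 1 , X 4 0F) ∷ (-int 1 , c₂ :- c₁) ∷ []) ρ
                 (X≈0 0F ∷ c₂-c₁ ∷ []) ≡.refl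
          1F → vanish 1 (power 2) 1
                 ((int 1 , pairSumₚ 4 2) ∷ (:- (a₂ :+ a₁) , a₂ :- a₁) ∷ (:- (b₂ :+ b₁) , b₂ :- b₁) ∷ (:- (c₂ :+ c₁) , c₂ :- c₁) ∷ []) ρ
                 (p≈0 0F ∷ a₂-a₁ ∷ b₂-b₁ ∷ c₂-c₁ ∷ []) ≡.refl
          2F → vanish 1 (power 3) 1
                 ((int 1 , pairSumₚ 4 3) ∷ (:- q a₂ a₁ , a₂ :- a₁) ∷ (:- q b₂ b₁ , b₂ :- b₁) ∷ (:- q c₂ c₁ , c₂ :- c₁) ∷ []) ρ
                 (p≈0 1F ∷ a₂-a₁ ∷ b₂-b₁ ∷ c₂-c₁ ∷ []) ≡.refl
        where
        power : ℕ → Polynomial 6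
        power k = sumₚ λ i → abc i :^ k
        q : Polynomial 6 → Polynomial 6 → Polynomial 6
        q s t = s :^ 2 :+ s :* t :+ t :^ 2

    edgeWeights≈0₄ : ∀ e → x e ≈ 0#
    edgeWeights≈0₄ = fromValues 4 x λ where
        0F → abc≈0 0F
        1F → abc≈0 1F
        2F → abc≈0 2F
        3F → opposite c₂ c₁ (abc≈0 2F) c₂-c₁ ≡.refl
        4F → opposite b₂ b₁ (abc≈0 1F) b₂-b₁ ≡.refl
        5F → opposite a₂ a₁ (abc≈0 0F) a₂-a₁ ≡.refl
      where
      opposite : ∀ s t → ⟦ t ⟧ ρ ≈ 0# → ⟦ s :- t ⟧ ρ ≈ 0# → _ → ⟦ s ⟧ ρ ≈ 0#
      opposite s t t≈0 s-t≈0 = vanish 0 s 1 ((int 1 , t) ∷ (int 1 , s :- t) ∷ []) ρ (t≈0 ∷ s-t≈0 ∷ [])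

  -- Five vertices: six points of sum zero.

  -- The ten splittings 3 + 3 of six points of sum zero, each represented by the signed
  -- triple that omits the sixth point -(y₀ + … + y₄).  The signs are those for which the
  -- vertex sums of the resulting edge weights vanish; edges are ordered as in `pairs 5`.
  form : ∀ {m} → (Fin 5 → Polynomial m) → Fin 10 → Polynomial m
  form y 0F = :- (y 1F :+ y 3F :+ y 4F)
  form y 1F = y 1F :+ y 2F :+ y 3F
  form y 2F = y 0F :+ y 3F :+ y 4F
  form y 3F = :- (y 0F :+ y 1F :+ y 2F)
  form y 4F = y 1F :+ y 2F :+ y 4F
  form y 5F = :- (y 2F :+ y 3F :+ y 4F)
  form y 6F = y 0F :+ y 1F :+ y 4F
  form y 7F = :- (y 0F :+ y 2F :+ y 4F)
  form y 8F = :- (y 0F :+ y 1F :+ y 3F)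
  form y 9F = y 0F :+ y 2F :+ y 3F

  P : ℕ → Polynomial 5
  P k = sumₚ λ v → form var v :^ k

  -- With the sixth point eliminated, `e 1` is zero identically.
  sixPoints : List (Polynomial 5)
  sixPoints = :- sumₚ var ∷ vars 5

  e : ℕ → Polynomial 5
  e k = esym k sixPoints

  module _ (ρ : Vec Carrier 5)
    (P₂≈0 : ⟦ P 2 ⟧ ρ ≈ 0#) (P₃≈0 : ⟦ P 3 ⟧ ρ ≈ 0#) (P₄≈0 : ⟦ P 4 ⟧ ρ ≈ 0#)
    (P₅≈0 : ⟦ P 5 ⟧ ρ ≈ 0#) (P₆≈0 : ⟦ P 6 ⟧ ρ ≈ 0#) where

    e₂≈0 : ⟦ e 2 ⟧ ρ ≈ 0#
    e₂≈0 = vanish 5 (e 2) 1 ((-int 1 , P 2) ∷ []) ρ (P₂≈0 ∷ []) ≡.refl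

    -- In terms of the elementary symmetric functions, P₂ = -6 e₂ and P₄ = 12 e₄ + 6 e₂².
    e₄≈0 : ⟦ e 4 ⟧ ρ ≈ 0#
    e₄≈0 = vanish 11 (e 4) 1 ((int 1 , P 4) ∷ (P 2 , e 2) ∷ []) ρ (P₄≈0 ∷ e₂≈0 ∷ []) ≡.refl

    -- The identities for e₅² and e₃⁴ were found by solving a linear system for the
    -- coefficients of the products of degree 10 and 12 of e₃, e₅ and the P k.
    e₅≈0 : ⟦ e 5 ⟧ ρ ≈ 0#
    e₅≈0 = vanish 467774999 (e 5) 2
      ( (int 6237000 :* e 3 :* e 5 :+ P 2 :* (-int 505575 :* e 3 :^ 2 :+ int 3500 :* P 2 :^ 3) , P 2)
      -- Nothing is known about the value of `P 7`; it occurs only in a cofactor.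
      ∷ (int 356400 :* P 7 :+ int 51975 :* P 3 :* P 2 :^ 2 , P 3)
      ∷ (int 4847850 :* e 3 :^ 2 :+ P 2 :* (-int 64400 :* P 2 :^ 2 :+ int 294000 :* P 4) :+ -int 103950 :* P 3 :^ 2 , P 4)
      ∷ (int 149688 :* P 5 :+ -int 249480 :* P 3 :* P 2 , P 5)
      ∷ (int 50400 :* P 2 :^ 2 :+ -int 504000 :* P 4 , P 6)
      ∷ []) ρ (P₂≈0 ∷ P₃≈0 ∷ P₄≈0 ∷ P₅≈0 ∷ P₆≈0 ∷ []) ≡.refl

    e₃²≈0 : ⟦ e 3 :^ 2 ⟧ ρ ≈ 0#
    e₃²≈0 = vanish 706816529 (e 3 :^ 2) 2
      ( (int 8027019000 :* e 5 :^ 2 :+ P 2 :* (-int 125550810 :* e 3 :* e 5 :+ P 2 :* (int 15569820 :* e 3 :^ 2 :+ -int 72100 :* P 2 :^ 3)) , P 2)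
      ∷ (-int 5488560 :* P 9 :+ P 3 :* (-int 343035 :* P 2 :^ 3 :+ -int 76230 :* P 3 :^ 2) , P 3)
      ∷ (int 185238900 :* e 3 :* e 5 :+ P 2 :* (-int 126707490 :* e 3 :^ 2 :+ P 2 :* (int 1202040 :* P 2 :^ 2 :+ -int 5009760 :* P 4)) , P 4)
      ∷ (-int 4234032 :* P 7 :+ P 3 :* (int 1234926 :* P 2 :^ 2 :+ int 2469852 :* P 4) , P 5)
      ∷ (int 56030940 :* e 3 :^ 2 :+ P 2 :* (-int 912240 :* P 2 :^ 2 :+ int 7529760 :* P 4) :+ int 1814400 :* P 6 :+ int 1372140 :* P 3 :^ 2 , P 6)
      ∷ []) ρ (P₂≈0 ∷ P₃≈0 ∷ P₄≈0 ∷ P₅≈0 ∷ P₆≈0 ∷ []) ≡.refl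

    e₃≈0 : ⟦ e 3 ⟧ ρ ≈ 0#
    e₃≈0 = reduced 2 _ e₃²≈0

    -- This is 22 e₆ = e₃² modulo P₂, P₄, P₆, multiplied by 648 to clear denominators.
    e₆≈0 : ⟦ e 6 ⟧ ρ ≈ 0#
    e₆≈0 = vanish 14255 (e 6) 1
      ((-int 72 , P 6) ∷ (-int 252 :* P 4 , e 2) ∷ (-int 5 :* P 2 :^ 2 , P 2) ∷ (int 648 :* e 3 , e 3) ∷ []) ρ
      (P₆≈0 ∷ e₂≈0 ∷ P₂≈0 ∷ e₃≈0 ∷ []) ≡.refl

    -- Each y_a is a root of the polynomial T⁶ + e₂ T⁴ - e₃ T³ + e₄ T² - e₅ T + e₆ whose roots are
    -- the six points, so y_a⁶ vanishes.
    y≈0 : ∀ a → ⟦ var a ⟧ ρ ≈ 0#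
    y≈0 = λ where
        0F → go 0F ≡.refl
        1F → go 1F ≡.refl
        2F → go 2F ≡.refl
        3F → go 3F ≡.refl
        4F → go 4F ≡.refl
      where
      go : ∀ a → _ → ⟦ var a ⟧ ρ ≈ 0#
      go a = vanish 0 (var a) 6
        ((-int 1 :* var a :^ 4 , e 2) ∷ (var a :^ 3 , e 3) ∷ (-int 1 :* var a :^ 2 , e 4) ∷ (var a , e 5) ∷ (-int 1 , e 6) ∷ [])
        ρ (e₂≈0 ∷ e₃≈0 ∷ e₄≈0 ∷ e₅≈0 ∷ e₆≈0 ∷ [])

  module _ (x : Pair 5 → Carrier) (X≈0 : ∀ i → vertexSum x i ≈ 0#)
    (p≈0 : ∀ (k : Fin 5) → pairSum x (2 ℕ.+ toℕ k) ≈ 0#) where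

    private
      ρ = values 5 x

      -- Summing the edges, signed according to the side of the splitting that contains
      -- the point a, gives 6 y_a.
      signs : Fin 5 → Vec Bool 10
      signs 0F = true ∷ false ∷ true ∷ false ∷ false ∷ true ∷ true ∷ false ∷ false ∷ true ∷ []
      signs 1F = false ∷ true ∷ false ∷ false ∷ true ∷ true ∷ true ∷ true ∷ false ∷ false ∷ []
      signs 2F = true ∷ true ∷ false ∷ false ∷ true ∷ false ∷ false ∷ false ∷ true ∷ true ∷ []
      signs 3F = false ∷ true ∷ true ∷ true ∷ false ∷ false ∷ false ∷ true ∷ false ∷ true ∷ []
      signs 4F = false ∷ false ∷ true ∷ true ∷ true ∷ false ∷ true ∷ false ∷ true ∷ false ∷ []

      Y : Fin 5 → Polynomial 10
      Y a = sumₚ λ v → if Vec.lookup (signs a) v then var v else :- var v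

      η : Vec Carrier 5
      η = Vec.tabulate λ a → ⟦ Y a ⟧ ρ

      -- Here `form Y v` is three times the edge v, minus the six edges adjacent to it, plus the
      -- three disjoint from it. Twice its difference from 6 x_v is a combination of vertex sums,
      -- with coefficient -3 at the ends of v and 1 elsewhere.
      form-Y : ∀ v → ⟦ form Y v :- int 6 :* var v ⟧ ρ ≈ 0#
      form-Y = λ where
          0F → go 0F ≡.refl
          1F → go 1F ≡.refl
          2F → go 2F ≡.refl
          3F → go 3F ≡.refl
          4F → go 4F ≡.refl
          5F → go 5F ≡.refl
          6F → go 6F ≡.refl
          7F → go 7F ≡.refl
          8F → go 8F ≡.refl
          9F → go 9F ≡.refl
        where
        coefficient : Fin 10 → Fin 5 → Polynomial 10
        coefficient v i with List.lookup (pairs 5) v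
        ... | mkPair lo hi _ = if does (i ≟ lo) ∨ does (i ≟ hi) then -int 3 else int 1

        go : ∀ v → _ → _
        go v = vanish 1 (form Y v :- int 6 :* var v) 1
          (List.tabulate λ i → coefficient v i , X 5 i) ρ
          (X≈0 0F ∷ X≈0 1F ∷ X≈0 2F ∷ X≈0 3F ∷ X≈0 4F ∷ [])

      -- Evaluating the forms at the values of the `Y a` agrees with substituting the `Y a` first;
      -- this holds by computation once v is a closed numeral, hence the ten cases.
      form-η : ∀ v → ⟦ form var v ⟧ η ≈ ⟦ int 6 :* var v ⟧ ρ
      form-η v = trans (reflexive (form-subst v)) (x∙y⁻¹≈ε⇒x≈y _ _ (form-Y v))
        where
        open GroupProperties +-group using (x∙y⁻¹≈ε⇒x≈y)
        form-subst : ∀ v → ⟦ form var v ⟧ η ≡ ⟦ form Y v ⟧ ρ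
        form-subst 0F = ≡.refl
        form-subst 1F = ≡.refl
        form-subst 2F = ≡.refl
        form-subst 3F = ≡.refl
        form-subst 4F = ≡.refl
        form-subst 5F = ≡.refl
        form-subst 6F = ≡.refl
        form-subst 7F = ≡.refl
        form-subst 8F = ≡.refl
        form-subst 9F = ≡.refl

      P-η : ∀ k → ⟦ sumₚ (λ v → (int 6 :* var v) :^ k) ⟧ ρ ≈ 0# → ⟦ P k ⟧ η ≈ 0#
      P-η k = trans (sum-cong-≋ λ v → ^-congˡ k (form-η v))

      scaled : ∀ k → pairSum x k ≈ 0# → _ → ⟦ sumₚ (λ v → (int 6 :* var v) :^ k) ⟧ ρ ≈ 0#
      scaled k pₖ≈0 = vanish 0 (sumₚ λ v → (int 6 :* var v) :^ k) 1
        ((int (6 ℕ.^ k) , pairSumₚ 5 k) ∷ []) ρ (pₖ≈0 ∷ [])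

      Y≈0 : ∀ a → ⟦ Y a ⟧ ρ ≈ 0#
      Y≈0 a = trans (reflexive (≡.sym (lookup∘tabulate (λ a → ⟦ Y a ⟧ ρ) a)))
        (y≈0 η
          (P-η 2 (scaled 2 (p≈0 0F) ≡.refl))
          (P-η 3 (scaled 3 (p≈0 1F) ≡.refl))
          (P-η 4 (scaled 4 (p≈0 2F) ≡.refl))
          (P-η 5 (scaled 5 (p≈0 3F) ≡.refl))
          (P-η 6 (scaled 6 (p≈0 4F) ≡.refl)) a)

    edgeWeights≈0₅ : ∀ e → x e ≈ 0#
    edgeWeights≈0₅ = fromValues 5 x λ where
        0F → go 0F ≡.refl
        1F → go 1F ≡.refl
        2F → go 2F ≡.refl
        3F → go 3F ≡.refl
        4F → go 4F ≡.refl
        5F → go 5F ≡.refl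
        6F → go 6F ≡.refl
        7F → go 7F ≡.refl
        8F → go 8F ≡.refl
        9F → go 9F ≡.refl
      where
      -- Unit vectors: the coefficient of `Y a` in the linear form `form Y v` is the value of the
      -- form at the a-th one.
      δ : Fin 5 → Fin 5 → Polynomial 10
      δ a b = if does (a ≟ b) then int 1 else int 0

      go : ∀ v → _ → _
      go v = vanish 5 (var v) 1
        ((-int 1 , form Y v :- int 6 :* var v) ∷ List.tabulate λ a → form (δ a) v , Y a) ρ
        (form-Y v ∷ Y≈0 0F ∷ Y≈0 1F ∷ Y≈0 2F ∷ Y≈0 3F ∷ Y≈0 4F ∷ [])

-- The radical of the ideal (θ) and the reduced quotient ring.

module Radical {c ℓ} (R : CommutativeRing c ℓ) (θ : List (CommutativeRing.Carrier R)) where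

  open CommutativeRing R hiding (zero)
  open SemiringSum semiring using (sum)
  open Exp commutativeSemiring
  open SemiringMult semiring
  open RingProperties ring
  open SetoidReasoning setoid

  -- Membership is inductive so that later proofs can recurse on how an element was built; `respᴵ`
  -- is a constructor because elements are compared by `_≈_`.
  data Ideal : Carrier → Set (c ⊔ ℓ) where
    zeroᴵ : Ideal 0#
    multᴵ : ∀ {t} a → t ∈ θ → Ideal (a * t)
    addᴵ  : ∀ {p q} → Ideal p → Ideal q → Ideal (p + q)
    respᴵ : ∀ {p q} → p ≈ q → Ideal p → Ideal q

  scaleᴵ : ∀ a {p} → Ideal p → Ideal (a * p)
  scaleᴵ a zeroᴵ          = respᴵ (sym (zeroʳ a)) zeroᴵ
  scaleᴵ a (multᴵ b t∈θ)  = respᴵ (*-assoc a b _) (multᴵ (a * b) t∈θ)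
  scaleᴵ a (addᴵ p∈I q∈I) = respᴵ (sym (distribˡ a _ _)) (addᴵ (scaleᴵ a p∈I) (scaleᴵ a q∈I))
  scaleᴵ a (respᴵ p≈q p∈I) = respᴵ (*-congˡ p≈q) (scaleᴵ a p∈I)

  Rad : Carrier → Set (c ⊔ ℓ)
  Rad p = ∃[ k ] Ideal (p ^ k)

  respᴿ : ∀ {p q} → p ≈ q → Rad p → Rad q
  respᴿ p≈q (k , h) = k , respᴵ (^-congˡ k p≈q) h

  Ideal⇒Rad : ∀ {p} → Ideal p → Rad p
  Ideal⇒Rad p∈I = 1 , respᴵ (sym (*-identityʳ _)) p∈I

  scaleᴿ : ∀ a {p} → Rad p → Rad (a * p)
  scaleᴿ a {p} (k , h) = k , respᴵ (sym (^-distrib-* a p k)) (scaleᴵ (a ^ k) h)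

  -- The factor a is what makes the induction go through.
  +-power : ∀ {p q} k l a → Ideal (a * p ^ k) → Ideal (a * q ^ l) → Ideal (a * (p + q) ^ (k ℕ.+ l))
  +-power {p} {q} zero l a hp _ =
    respᴵ (*-comm _ _) (scaleᴵ ((p + q) ^ l) (respᴵ (*-identityʳ a) hp))
  +-power {p} {q} (suc k) zero a _ hq =
    respᴵ (*-comm _ _) (scaleᴵ ((p + q) ^ (suc k ℕ.+ 0)) (respᴵ (*-identityʳ a) hq))
  +-power {p} {q} (suc k) (suc l) a hp hq = respᴵ eq (addᴵ
      (+-power k (suc l) (a * p) (respᴵ (sym (*-assoc _ _ _)) hp)
        (respᴵ (x∙yz≈yx∙z p a _) (scaleᴵ p hq)))
      (respᴵ (*-congˡ (^-congʳ (p + q) (≡.sym (ℕₚ.+-suc k l))))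
        (+-power (suc k) l (a * q)
          (respᴵ (x∙yz≈yx∙z q a _) (scaleᴵ q hp)) (respᴵ (sym (*-assoc _ _ _)) hq))))
    where
    open CommutativeSemigroupProperties *-commutativeSemigroup using (x∙yz≈yx∙z)
    s = (p + q) ^ (k ℕ.+ suc l)
    eq : a * p * s + a * q * s ≈ a * ((p + q) * s)
    eq = begin
      a * p * s + a * q * s ≈⟨ distribʳ s (a * p) (a * q) ⟨
      (a * p + a * q) * s   ≈⟨ *-congʳ (distribˡ a p q) ⟨
      a * (p + q) * s       ≈⟨ *-assoc _ _ _ ⟩
      a * ((p + q) * s)     ∎

  addᴿ : ∀ {p q} → Rad p → Rad q → Rad (p + q)
  addᴿ (k , hp) (l , hq) = k ℕ.+ l , respᴵ (*-identityˡ _) (+-power k l 1#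
    (respᴵ (sym (*-identityˡ _)) hp) (respᴵ (sym (*-identityˡ _)) hq))

  infix 4 _~_
  _~_ : Carrier → Carrier → Set (c ⊔ ℓ)
  x ~ y = Rad (x - y)

  ≈⇒~ : ∀ {x y} → x ≈ y → x ~ y
  ≈⇒~ x≈y = respᴿ (sym (x≈y⇒x-y≈0 x≈y)) (Ideal⇒Rad zeroᴵ)
    where
    x≈y⇒x-y≈0 : ∀ {x y} → x ≈ y → x - y ≈ 0#
    x≈y⇒x-y≈0 x≈y = trans (+-congʳ x≈y) (-‿inverseʳ _)

  Rad⇒~0 : ∀ {x} → Rad x → x ~ 0#
  Rad⇒~0 = respᴿ (sym (trans (+-congˡ -0#≈0#) (+-identityʳ _)))

  ~0⇒Rad : ∀ {x} → x ~ 0# → Rad x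
  ~0⇒Rad = respᴿ (trans (+-congˡ -0#≈0#) (+-identityʳ _))

  ~-neg-cong : ∀ {x y} → x ~ y → - x ~ - y
  ~-neg-cong {x} {y} h = respᴿ (trans (-1*x≈-x _) (sym (-‿+-comm x (- y)))) (scaleᴿ (- 1#) h)

  ~-sym : ∀ {x y} → x ~ y → y ~ x
  ~-sym {x} {y} h = respᴿ (begin
    - 1# * (x - y)  ≈⟨ -1*x≈-x _ ⟩
    - (x - y)       ≈⟨ ⁻¹-anti-homo‿- x y ⟩
    y - x           ∎) (scaleᴿ (- 1#) h)

  telescope : ∀ x y z → (x - y) + (y - z) ≈ x - z
  telescope x y z = begin
    (x - y) + (y - z)   ≈⟨ +-assoc x (- y) (y - z) ⟩
    x + (- y + (y - z)) ≈⟨ +-congˡ (+-assoc (- y) y (- z)) ⟨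
    x + (- y + y - z)   ≈⟨ +-congˡ (trans (+-congʳ (-‿inverseˡ y)) (+-identityˡ _)) ⟩
    x - z               ∎

  ~-trans : ∀ {x y z} → x ~ y → y ~ z → x ~ z
  ~-trans {x} {y} {z} h g = respᴿ (telescope x y z) (addᴿ h g)

  ~-+-cong : ∀ {x y u v} → x ~ y → u ~ v → x + u ~ y + v
  ~-+-cong {x} {y} {u} {v} h g =
    respᴿ (trans (interchange x (- y) u (- v)) (+-congˡ (-‿+-comm y v))) (addᴿ h g)
    where
    open CommutativeSemigroupProperties +-commutativeSemigroup using (interchange)

  ~-*-cong : ∀ {x y u v} → x ~ y → u ~ v → x * u ~ y * v
  ~-*-cong {x} {y} {u} {v} h g = respᴿ (begin
    u * (x - y) + y * (u - v)             ≈⟨ +-cong (trans (*-comm u _) ([y-z]x≈yx-zx u x y)) (x[y-z]≈xy-xz y u v) ⟩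
    (x * u - y * u) + (y * u - y * v)     ≈⟨ telescope _ _ _ ⟩
    x * u - y * v                         ∎) (addᴿ (scaleᴿ u h) (scaleᴿ y g))

  -- Carrier and operations are kept and only the equality is coarsened, so polynomials serve as
  -- their own residue classes.
  reducedQuotient : CommutativeRing c (c ⊔ ℓ)
  reducedQuotient = record
    { Carrier = Carrier ; _≈_ = _~_ ; _+_ = _+_ ; _*_ = _*_ ; -_ = -_ ; 0# = 0# ; 1# = 1#
    ; isCommutativeRing = record
      { isRing = record
        { +-isAbelianGroup = record
          { isGroup = record
            { isMonoid = record
              { isSemigroup = record
                { isMagma = record
                  { isEquivalence = record { refl = ≈⇒~ refl ; sym = ~-sym ; trans = ~-trans }
                  ; ∙-cong = ~-+-cong
                  }
                ; assoc = λ x y z → ≈⇒~ (+-assoc x y z)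
                }
              ; identity = (λ x → ≈⇒~ (+-identityˡ x)) , λ x → ≈⇒~ (+-identityʳ x)
              }
            ; inverse = (λ x → ≈⇒~ (-‿inverseˡ x)) , λ x → ≈⇒~ (-‿inverseʳ x)
            ; ⁻¹-cong = ~-neg-cong
            }
          ; comm = λ x y → ≈⇒~ (+-comm x y)
          }
        ; *-cong = ~-*-cong
        ; *-assoc = λ x y z → ≈⇒~ (*-assoc x y z)
        ; *-identity = (λ x → ≈⇒~ (*-identityˡ x)) , λ x → ≈⇒~ (*-identityʳ x)
        ; distrib = (λ x y z → ≈⇒~ (distribˡ x y z)) , λ x y z → ≈⇒~ (distribʳ x y z)
        }
      ; *-comm = λ x y → ≈⇒~ (*-comm x y)
      }
    }

  module Q where
    open Exp (CommutativeRing.commutativeSemiring reducedQuotient) public using (_^_)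
    open SemiringMult (CommutativeRing.semiring reducedQuotient) public using (_×_)
    open SemiringSum (CommutativeRing.semiring reducedQuotient) public using (sum; sum-cong-≗)

  -- The operations of both rings coincide, but powers and sums with a variable number of
  -- factors or terms are stuck on the whole bundle, hence are not equal by definition.
  Q-^ : ∀ x k → x Q.^ k ≡ x ^ k
  Q-^ x zero    = ≡.refl
  Q-^ x (suc k) = ≡.cong (x *_) (Q-^ x k)

  Q-sum : ∀ {n} (f : Fin n → Carrier) → Q.sum f ≡ sum f
  Q-sum {zero}  f = ≡.refl
  Q-sum {suc n} f = ≡.cong (f zero +_) (Q-sum (f ∘ suc))

  Q-powerSum : ∀ {n} (f : Fin n → Carrier) k → Q.sum (λ i → f i Q.^ k) ≡ sum (λ i → f i ^ k)
  Q-powerSum f k = ≡.trans (Q.sum-cong-≗ λ i → Q-^ (f i) k) (Q-sum λ i → f i ^ k)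

  -- If (x^k)^l lies in the ideal, then so does x^(k l).
  Q-reduced : Reduced reducedQuotient
  Q-reduced k x h with l , hl ← ~0⇒Rad h =
    Rad⇒~0 (k ℕ.* l , respᴵ (trans (^-congˡ l (reflexive (Q-^ x k))) (^-assocʳ x k l)) hl)

  Q-torsionFree : (∀ d → ∃[ u ] u * (suc d × 1#) ≈ 1#) → TorsionFree reducedQuotient
  Q-torsionFree inverse d x h with u , eq ← inverse d = Rad⇒~0 (respᴿ (begin
    u * (suc d Q.× x)          ≡⟨ ≡.cong (u *_) (Q-× (suc d)) ⟩
    u * (suc d × x)            ≈⟨ *-congˡ (×-congʳ (suc d) (*-identityˡ x)) ⟨
    u * (suc d × (1# * x))     ≈⟨ *-congˡ (×-assoc-* (suc d) 1# x) ⟨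
    u * ((suc d × 1#) * x)     ≈⟨ *-assoc _ _ _ ⟨
    u * (suc d × 1#) * x       ≈⟨ *-congʳ eq ⟩
    1# * x                     ≈⟨ *-identityˡ x ⟩
    x                          ∎) (scaleᴿ u (~0⇒Rad h)))
    where
    Q-× : ∀ k → k Q.× x ≡ k × x
    Q-× zero    = ≡.refl
    Q-× (suc k) = ≡.cong (x +_) (Q-× k)

-- Sequences under the Cauchy product.

module CauchyProduct {c ℓ} (R : CommutativeRing c ℓ) where

  open CommutativeRing R
  open SetoidReasoning setoid
  open CommutativeSemigroupProperties +-commutativeSemigroup using (interchange; x∙yz≈y∙xz)

  Sequence : Set c
  Sequence = ℕ → Carrier

  private
    variable
      a a′ b b′ d : Sequence

  infix 4 _≋_
  _≋_ : Sequence → Sequence → Set ℓ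
  a ≋ b = ∀ n → a n ≈ b n

  infixl 7 _⊛_
  -- The coefficient Σ a_i b_j over i + j = n, arranged as a recursion that shifts `a`; this avoids
  -- subtraction of indices.
  _⊛_ : Sequence → Sequence → Sequence
  (a ⊛ b) zero    = a 0 * b 0
  (a ⊛ b) (suc n) = a 0 * b (suc n) + ((a ∘ suc) ⊛ b) n

  ⊛-cong : a ≋ a′ → b ≋ b′ → a ⊛ b ≋ a′ ⊛ b′
  ⊛-cong p q zero    = *-cong (p 0) (q 0)
  ⊛-cong p q (suc n) = +-cong (*-cong (p 0) (q (suc n))) (⊛-cong (p ∘ suc) q n)

  -- The definition peels off the term with index 0 of `a`; peeling at the other end is what makes
  -- commutativity an induction.
  ⊛-last : ∀ a b n → (a ⊛ b) (suc n) ≈ a (suc n) * b 0 + (a ⊛ (b ∘ suc)) n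
  ⊛-last a b zero    = +-comm _ _
  ⊛-last a b (suc n) = begin
    a 0 * b (2 ℕ.+ n) + ((a ∘ suc) ⊛ b) (suc n)                          ≈⟨ +-congˡ (⊛-last (a ∘ suc) b n) ⟩
    a 0 * b (2 ℕ.+ n) + (a (2 ℕ.+ n) * b 0 + ((a ∘ suc) ⊛ (b ∘ suc)) n)  ≈⟨ x∙yz≈y∙xz _ _ _ ⟩
    a (2 ℕ.+ n) * b 0 + (a 0 * b (2 ℕ.+ n) + ((a ∘ suc) ⊛ (b ∘ suc)) n)  ∎

  ⊛-comm : ∀ a b → a ⊛ b ≋ b ⊛ a
  ⊛-comm a b zero    = *-comm _ _
  ⊛-comm a b (suc n) = begin
    a 0 * b (suc n) + ((a ∘ suc) ⊛ b) n  ≈⟨ +-cong (*-comm _ _) (⊛-comm (a ∘ suc) b n) ⟩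
    b (suc n) * a 0 + (b ⊛ (a ∘ suc)) n  ≈⟨ ⊛-last b a n ⟨
    (b ⊛ a) (suc n)                      ∎

  ⊛-distribˡ : ∀ a b d → (a ⊛ λ n → b n + d n) ≋ λ n → (a ⊛ b) n + (a ⊛ d) n
  ⊛-distribˡ a b d zero    = distribˡ _ _ _
  ⊛-distribˡ a b d (suc n) = trans (+-cong (distribˡ _ _ _) (⊛-distribˡ (a ∘ suc) b d n)) (interchange _ _ _ _)

  ⊛-distribʳ : ∀ a b d → ((λ n → a n + b n) ⊛ d) ≋ λ n → (a ⊛ d) n + (b ⊛ d) n
  ⊛-distribʳ a b d zero    = distribʳ _ _ _
  ⊛-distribʳ a b d (suc n) = trans (+-cong (distribʳ _ _ _) (⊛-distribʳ (a ∘ suc) (b ∘ suc) d n)) (interchange _ _ _ _)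

  ⊛-scale : ∀ x a b → (λ n → x * a n) ⊛ b ≋ λ n → x * (a ⊛ b) n
  ⊛-scale x a b zero    = *-assoc _ _ _
  ⊛-scale x a b (suc n) = trans (+-cong (*-assoc _ _ _) (⊛-scale x (a ∘ suc) b n)) (sym (distribˡ _ _ _))

  ⊛-assoc : ∀ a b d → (a ⊛ b) ⊛ d ≋ a ⊛ (b ⊛ d)
  ⊛-assoc a b d zero    = *-assoc _ _ _
  ⊛-assoc a b d (suc n) = begin
    a 0 * b 0 * d (suc n) + ((λ m → a 0 * b (suc m) + ((a ∘ suc) ⊛ b) m) ⊛ d) n
      ≈⟨ +-cong (*-assoc _ _ _) (⊛-distribʳ (λ m → a 0 * b (suc m)) ((a ∘ suc) ⊛ b) d n) ⟩
    a 0 * (b 0 * d (suc n)) + (((λ m → a 0 * b (suc m)) ⊛ d) n + (((a ∘ suc) ⊛ b) ⊛ d) n)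
      ≈⟨ +-congˡ (+-cong (⊛-scale (a 0) (b ∘ suc) d n) (⊛-assoc (a ∘ suc) b d n)) ⟩
    a 0 * (b 0 * d (suc n)) + (a 0 * ((b ∘ suc) ⊛ d) n + ((a ∘ suc) ⊛ (b ⊛ d)) n)
      ≈⟨ +-assoc _ _ _ ⟨
    a 0 * (b 0 * d (suc n)) + a 0 * ((b ∘ suc) ⊛ d) n + ((a ∘ suc) ⊛ (b ⊛ d)) n
      ≈⟨ +-congʳ (distribˡ _ _ _) ⟨
    a 0 * (b 0 * d (suc n) + ((b ∘ suc) ⊛ d) n) + ((a ∘ suc) ⊛ (b ⊛ d)) n ∎

  -- The sequence of coefficients of the monomial x T^d.
  at : ℕ → Carrier → Sequence
  at zero    x zero    = x
  at zero    x (suc n) = 0#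
  at (suc d) x zero    = 0#
  at (suc d) x (suc n) = at d x n

  at-cong : ∀ d {x y} → x ≈ y → at d x ≋ at d y
  at-cong zero    x≈y zero    = x≈y
  at-cong zero    x≈y (suc n) = refl
  at-cong (suc d) x≈y zero    = refl
  at-cong (suc d) x≈y (suc n) = at-cong d x≈y n

  at-zero : ∀ d → at d 0# ≋ const 0#
  at-zero zero    zero    = refl
  at-zero zero    (suc n) = refl
  at-zero (suc d) zero    = refl
  at-zero (suc d) (suc n) = at-zero d n

  at-+ : ∀ d x y → (λ n → at d x n + at d y n) ≋ at d (x + y)
  at-+ zero    x y zero    = refl
  at-+ zero    x y (suc n) = +-identityʳ 0#
  at-+ (suc d) x y zero    = +-identityʳ 0#
  at-+ (suc d) x y (suc n) = at-+ d x y n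

  at-refl : ∀ d x → at d x d ≈ x
  at-refl zero    x = refl
  at-refl (suc d) x = at-refl d x

  zero-⊛ : ∀ b → const 0# ⊛ b ≋ const 0#
  zero-⊛ b zero    = zeroˡ _
  zero-⊛ b (suc n) = trans (+-cong (zeroˡ _) (zero-⊛ b n)) (+-identityʳ 0#)

  at-zero-⊛ : ∀ x b → at 0 x ⊛ b ≋ λ n → x * b n
  at-zero-⊛ x b zero    = refl
  at-zero-⊛ x b (suc n) = trans (+-congˡ (zero-⊛ b n)) (+-identityʳ _)

  at-suc-⊛ : ∀ d x b n → (at (suc d) x ⊛ b) (suc n) ≈ (at d x ⊛ b) n
  at-suc-⊛ d x b n = trans (+-congʳ (zeroˡ _)) (+-identityˡ _)

  at-* : ∀ d x y → (λ n → x * at d y n) ≋ at d (x * y)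
  at-* zero    x y zero    = refl
  at-* zero    x y (suc n) = zeroʳ x
  at-* (suc d) x y zero    = zeroʳ x
  at-* (suc d) x y (suc n) = at-* d x y n

  at-⊛ : ∀ d e x y → at d x ⊛ at e y ≋ at (d ℕ.+ e) (x * y)
  at-⊛ zero    e x y n       = trans (at-zero-⊛ x (at e y) n) (at-* e x y n)
  at-⊛ (suc d) e x y zero    = zeroˡ _
  at-⊛ (suc d) e x y (suc n) = trans (at-suc-⊛ d x (at e y) n) (at-⊛ d e x y n)

-- The grading of the polynomial ring by degree.

module Grading {c ℓ} (R : CommutativeRing c ℓ) (V : Set) where

  open Polynomials R
  private module R = CommutativeRing R
  open CommutativeRing (polynomialRing V)
    using (setoid; zeroˡ; zeroʳ; +-identityʳ; +-congˡ; +-congʳ; ring; distribʳ; *-congˡ; *-congʳ; *-identityʳ; -‿inverseˡ; reflexive)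
  open CauchyProduct (polynomialRing V)
  open SetoidReasoning setoid

  component : Polynomial V → ℕ → Polynomial V
  component (con a) = at 0 (con a)
  component (var v) = at 1 (var v)
  component (p + q) n = component p n + component q n
  component (p * q) = component p ⊛ component q
  component (- p) n = - component p n

  -- Components are read off the expression, so independence of the representative needs proof: each
  -- ring law for polynomials is matched by the same law for sequences under the Cauchy product.
  component-cong : ∀ {p q} → p ≈ q → component p ≋ component q
  component-cong ≈-refl n = ≈-refl
  component-cong (≈-sym h) n = ≈-sym (component-cong h n)
  component-cong (≈-trans h g) n = ≈-trans (component-cong h n) (component-cong g n)
  component-cong (+-cong h g) n = +-cong (component-cong h n) (component-cong g n)
  component-cong (*-cong h g) = ⊛-cong (component-cong h) (component-cong g)
  component-cong (neg-cong h) n = neg-cong (component-cong h n)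
  component-cong (+-assoc p q r) n = +-assoc _ _ _
  component-cong (+-comm p q) n = +-comm _ _
  component-cong (+-identityˡ p) n = ≈-trans (+-congʳ (at-zero 0 n)) (+-identityˡ _)
  component-cong (+-inverseˡ p) n = ≈-trans (-‿inverseˡ _) (≈-sym (at-zero 0 n))
  component-cong (*-assoc p q r) = ⊛-assoc (component p) (component q) (component r)
  component-cong (*-comm p q) = ⊛-comm (component p) (component q)
  component-cong (*-identityˡ p) n = ≈-trans (at-zero-⊛ 1ₚ (component p) n) (*-identityˡ _)
  component-cong (distribˡ p q r) = ⊛-distribˡ (component p) (component q) (component r)
  component-cong (con-cong h) = at-cong 0 (con-cong h)
  component-cong (con-+ a b) n = ≈-trans (at-cong 0 (con-+ a b) n) (≈-sym (at-+ 0 (con a) (con b) n))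
  component-cong (con-* a b) n = ≈-trans (at-cong 0 (con-* a b) n) (≈-sym (at-⊛ 0 0 (con a) (con b) n))

  word : List V → Polynomial V
  word = List.foldr (λ v p → var v * p) 1ₚ

  word-++ : ∀ u w → word (u ++ w) ≈ word u * word w
  word-++ []      w = ≈-sym (*-identityˡ _)
  word-++ (v ∷ u) w = ≈-trans (*-congˡ (word-++ u w)) (≈-sym (*-assoc _ _ _))

  component-word : ∀ w → component (word w) ≋ at (List.length w) (word w)
  component-word []      n = ≈-refl
  component-word (v ∷ w) n = ≈-trans (⊛-cong (λ _ → ≈-refl) (component-word w) n) (at-⊛ 1 (List.length w) (var v) (word w) n)

  data Span (P : List V → Set) : Polynomial V → Set (c ⊔ ℓ) where
    zeroˢ : Span P 0ₚ
    termˢ : ∀ a w → P w → Span P (con a * word w)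
    addˢ  : ∀ {p q} → Span P p → Span P q → Span P (p + q)
    respˢ : ∀ {p q} → p ≈ q → Span P p → Span P q

  private
    variable
      P Q S : List V → Set
      p q : Polynomial V

  scaleˢ : ∀ a → Span P p → Span P (con a * p)
  scaleˢ a zeroˢ = respˢ (≈-sym (zeroʳ _)) zeroˢ
  scaleˢ a (termˢ b w Pw) = respˢ (≈-trans (*-congʳ (con-* a b)) (*-assoc _ _ _)) (termˢ (a R.* b) w Pw)
  scaleˢ a (addˢ h g) = respˢ (≈-sym (distribˡ _ _ _)) (addˢ (scaleˢ a h) (scaleˢ a g))
  scaleˢ a (respˢ p≈q h) = respˢ (*-congˡ p≈q) (scaleˢ a h)

  negˢ : Span P p → Span P (- p)
  negˢ {p = p} h = respˢ (begin
    con (R.- R.1#) * p    ≈⟨ *-congʳ con-neg ⟩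
    - 1ₚ * p              ≈⟨ -1*x≈-x p ⟩
    - p                   ∎) (scaleˢ (R.- R.1#) h)
    where
    open RingProperties ring
    con-neg : con (R.- R.1#) ≈ - 1ₚ
    con-neg = +-inverseˡ-unique _ _
      (≈-trans (≈-sym (con-+ _ _)) (con-cong (R.-‿inverseˡ R.1#)))

  wordˢ : ∀ w → P w → Span P (word w)
  wordˢ w Pw = respˢ (*-identityˡ _) (termˢ R.1# w Pw)

  mulˢ : (∀ u w → P u → Q w → S (u ++ w)) → Span P p → Span Q q → Span S (p * q)
  mulˢ f zeroˢ         g = respˢ (≈-sym (zeroˡ _)) zeroˢ
  mulˢ f (addˢ h h′)   g = respˢ (≈-sym (distribʳ _ _ _)) (addˢ (mulˢ f h g) (mulˢ f h′ g))
  mulˢ f (respˢ p≈q h) g = respˢ (*-congʳ p≈q) (mulˢ f h g)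
  mulˢ {P} {Q} {S} f (termˢ a u Pu) g = respˢ (≈-sym (*-assoc _ _ _)) (scaleˢ a (word-* g))
    where
    word-* : ∀ {q} → Span Q q → Span S (word u * q)
    word-* zeroˢ = respˢ (≈-sym (zeroʳ _)) zeroˢ
    word-* (addˢ h g) = respˢ (≈-sym (distribˡ _ _ _)) (addˢ (word-* h) (word-* g))
    word-* (respˢ p≈q h) = respˢ (*-congˡ p≈q) (word-* h)
    word-* (termˢ b w Qw) = respˢ (begin
      con b * word (u ++ w)      ≈⟨ *-congˡ (word-++ u w) ⟩
      con b * (word u * word w)  ≈⟨ x∙yz≈y∙xz _ _ _ ⟩
      word u * (con b * word w)  ∎) (termˢ b (u ++ w) (f u w Pu Qw))
      where
      open CommutativeSemigroupProperties (CommutativeRing.*-commutativeSemigroup (polynomialRing V)) using (x∙yz≈y∙xz)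

  conˢ : ∀ a → P [] → Span P (con a)
  conˢ a P[] = respˢ (*-identityʳ _) (termˢ a [] P[])

  varˢ : ∀ v → P (v ∷ []) → Span P (var v)
  varˢ v Pv = respˢ (*-identityʳ _) (wordˢ (v ∷ []) Pv)

  spanned : ∀ p → Span (const ⊤) p
  spanned (con a) = conˢ a tt
  spanned (var v) = varˢ v tt
  spanned (p + q) = addˢ (spanned p) (spanned q)
  spanned (p * q) = mulˢ (λ _ _ _ _ → tt) (spanned p) (spanned q)
  spanned (- p)   = negˢ (spanned p)

  HasLength : ℕ → List V → Set
  HasLength d w = List.length w ≡ d

  mulˢ-length : ∀ d e → Span (HasLength d) p → Span (HasLength e) q → Span (HasLength (d ℕ.+ e)) (p * q)
  mulˢ-length d e = mulˢ λ u w |u| |w| → ≡.trans (Listₚ.length-++ u) (≡.cong₂ ℕ._+_ |u| |w|)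

  ^ˢ-length : ∀ d k → Span (HasLength d) p → Span (HasLength (k ℕ.* d)) (p ^ k)
  ^ˢ-length d zero    h = conˢ R.1# ≡.refl
  ^ˢ-length d (suc k) h = mulˢ-length d (k ℕ.* d) h (^ˢ-length d k h)

  private
    relength : ∀ {d e} → d ≡ e → Span (HasLength d) p → Span (HasLength e) p
    relength ≡.refl h = h

  -- The offset k is needed for the induction, since the recursion of `_⊛_` shifts `a` and thereby
  -- raises the degrees of its entries by one.
  ⊛-spanned : ∀ k {a b} → (∀ n → Span (HasLength (k ℕ.+ n)) (a n)) → (∀ n → Span (HasLength n) (b n)) →
    ∀ n → Span (HasLength (k ℕ.+ n)) ((a ⊛ b) n)
  ⊛-spanned k ha hb zero    = relength (ℕₚ.+-identityʳ (k ℕ.+ 0)) (mulˢ-length (k ℕ.+ 0) 0 (ha 0) (hb 0))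
  ⊛-spanned k ha hb (suc n) = addˢ
    (relength (≡.cong (ℕ._+ suc n) (ℕₚ.+-identityʳ k)) (mulˢ-length (k ℕ.+ 0) (suc n) (ha 0) (hb (suc n))))
    (relength (≡.sym (ℕₚ.+-suc k n))
      (⊛-spanned (suc k) (λ m → relength (ℕₚ.+-suc k m) (ha (suc m))) hb n))

  component-spanned : ∀ p n → Span (HasLength n) (component p n)
  component-spanned (con a) zero          = conˢ a ≡.refl
  component-spanned (con a) (suc n)       = zeroˢ
  component-spanned (var v) zero          = zeroˢ
  component-spanned (var v) (suc zero)    = varˢ v ≡.refl
  component-spanned (var v) (suc (suc n)) = zeroˢ
  component-spanned (p + q) n = addˢ (component-spanned p n) (component-spanned q n)
  component-spanned (p * q)   = ⊛-spanned 0 (component-spanned p) (component-spanned q)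
  component-spanned (- p)   n = negˢ (component-spanned p n)

  component-at : ∀ {d p} → Span (HasLength d) p → component p ≋ at d p
  component-at {d} zeroˢ n = ≈-trans (at-zero 0 n) (≈-sym (at-zero d n))
  component-at (termˢ a w ≡.refl) n =
    ≈-trans (⊛-cong (λ _ → ≈-refl) (component-word w) n) (at-⊛ 0 (List.length w) (con a) (word w) n)
  component-at {d} (addˢ h g) n = ≈-trans (+-cong (component-at h n) (component-at g n)) (at-+ d _ _ n)
  component-at {d} (respˢ p≈q h) n =
    ≈-trans (component-cong (≈-sym p≈q) n) (≈-trans (component-at h n) (at-cong d p≈q n))

  homogeneous : ∀ {d p} → Span (HasLength d) p → Homogeneous d p
  homogeneous zeroˢ = [] , ≈-refl
  homogeneous (termˢ a w ≡.refl) = (a , Vec.fromList w) ∷ [] ,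
    ≈-trans (≈-sym (+-identityʳ _)) (+-congʳ (*-congˡ (reflexive (≡.sym (monomial-fromList w)))))
    where
    monomial-fromList : ∀ w → monomial (Vec.fromList w) ≡ word w
    monomial-fromList []      = ≡.refl
    monomial-fromList (v ∷ w) = ≡.cong (var v *_) (monomial-fromList w)
  homogeneous {d} (addˢ h g) with ts , eq ← homogeneous h | us , eq′ ← homogeneous g =
    ts ++ us , ≈-trans (+-cong eq eq′) (≈-sym (sum-++ ts us))
    where
    Σₜ : List (R.Carrier Product.× Vec V d) → Polynomial V
    Σₜ = List.foldr (λ (a , vs) q → con a * monomial vs + q) 0ₚ
    sum-++ : ∀ ts us → Σₜ (ts ++ us) ≈ Σₜ ts + Σₜ us
    sum-++ []       us = ≈-sym (+-identityˡ _)
    sum-++ (t ∷ ts) us = ≈-trans (+-congˡ (sum-++ ts us)) (≈-sym (+-assoc _ _ _))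
  homogeneous (respˢ p≈q h) with ts , eq ← homogeneous h = ts , ≈-trans (≈-sym p≈q) eq

-- The subalgebra generated by θ and linear combinations over it.

module Combinations {c ℓ} (R : CommutativeRing c ℓ) (V : Set)
  (θ : List (Polynomials.Polynomial R V)) where

  open Polynomials R
  open CommutativeRing (polynomialRing V) using (setoid; semiring; zeroˡ; +-identityʳ; +-congʳ; distribʳ; *-congˡ)
  open SemiringSum semiring using (sum-cong-≋; sum-replicate-zero; ∑-distrib-+; *-distribˡ-sum)
  open SetoidReasoning setoid

  con∈R[θ] : ∀ a → con a ∈R[ θ ]
  con∈R[θ] a = con a , ≈-refl

  θ∈R[θ] : ∀ {t} → t ∈ θ → t ∈R[ θ ]
  θ∈R[θ] t∈θ = var (Any.index t∈θ) , CommutativeRing.reflexive (polynomialRing V) (lookup-index t∈θ)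

  +∈R[θ] : ∀ {p q} → p ∈R[ θ ] → q ∈R[ θ ] → (p + q) ∈R[ θ ]
  +∈R[θ] (P , p≈) (Q , q≈) = P + Q , +-cong p≈ q≈

  *∈R[θ] : ∀ {p q} → p ∈R[ θ ] → q ∈R[ θ ] → (p * q) ∈R[ θ ]
  *∈R[θ] (P , p≈) (Q , q≈) = P * Q , *-cong p≈ q≈

  record _∈Module_ (p : Polynomial V) (gs : List (Polynomial V)) : Set (c ⊔ ℓ) where
    constructor combination
    field
      coefficient       : Fin (length gs) → Polynomial V
      coefficient∈R[θ]  : ∀ k → coefficient k ∈R[ θ ]
      isCombination     : p ≈ sum (λ k → coefficient k * lookup gs k)

  private
    variable
      p q : Polynomial V
      gs : List (Polynomial V)

  respᴹ : p ≈ q → p ∈Module gs → q ∈Module gs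
  respᴹ p≈q (combination a a∈ eq) = combination a a∈ (≈-trans (≈-sym p≈q) eq)

  zeroᴹ : 0ₚ ∈Module gs
  zeroᴹ {gs} = combination (const 0ₚ) (λ _ → con∈R[θ] _)
    (≈-sym (≈-trans (sum-cong-≋ λ k → zeroˡ (lookup gs k)) (sum-replicate-zero (length gs))))

  addᴹ : p ∈Module gs → q ∈Module gs → (p + q) ∈Module gs
  addᴹ {gs = gs} (combination a a∈ eq) (combination b b∈ eq′) =
    combination (λ k → a k + b k) (λ k → +∈R[θ] (a∈ k) (b∈ k))
      (≈-trans (+-cong eq eq′) (≈-trans (≈-sym (∑-distrib-+ (λ k → a k * lookup gs k) (λ k → b k * lookup gs k)))
        (sum-cong-≋ λ k → ≈-sym (distribʳ (lookup gs k) (a k) (b k)))))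

  scaleᴹ : q ∈R[ θ ] → p ∈Module gs → (q * p) ∈Module gs
  scaleᴹ {q} {gs = gs} q∈ (combination a a∈ eq) =
    combination (λ k → q * a k) (λ k → *∈R[θ] q∈ (a∈ k))
      (≈-trans (*-congˡ eq) (≈-trans (*-distribˡ-sum q (λ k → a k * lookup gs k))
        (sum-cong-≋ λ k → ≈-sym (*-assoc q (a k) (lookup gs k)))))

  generatorᴹ : p ∈ gs → p ∈Module gs
  generatorᴹ {p} (here {xs = gs} ≡.refl) = combination
    (λ { zero → 1ₚ ; (suc k) → 0ₚ })
    (λ { zero → con∈R[θ] _ ; (suc k) → con∈R[θ] _ })
    (≈-sym (≈-trans (+-cong (*-identityˡ p) (≈-trans (sum-cong-≋ λ k → zeroˡ (lookup gs k)) (sum-replicate-zero (length gs))))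
      (+-identityʳ p)))
  generatorᴹ {p} (there {x = g} p∈gs) with combination a a∈ eq ← generatorᴹ p∈gs = combination
    (λ { zero → 0ₚ ; (suc k) → a k })
    (λ { zero → con∈R[θ] _ ; (suc k) → a∈ k })
    (≈-trans eq (≈-sym (≈-trans (+-congʳ (zeroˡ g)) (+-identityˡ _))))

-- A graded Nakayama argument.

module GradedNakayama {c ℓ} (R : CommutativeRing c ℓ) {V : Set}
  (vs : List V) (∈vs : ∀ v → v ∈ vs) (θ : List (Polynomials.Polynomial R V))
  (positiveDegree : ∀ {t} → t ∈ θ → ∃[ e ] Grading.Span R V (Grading.HasLength R V (suc e)) t)
  (nilpotent : ∀ v → Radical.Rad (Polynomials.polynomialRing R V) θ (Polynomials.var v))
  where

  open Polynomials R
  open Grading R V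
  open Radical (polynomialRing V) θ
  open Combinations R V θ
  open CauchyProduct (polynomialRing V)
  open CommutativeRing (polynomialRing V) using (setoid; *-congˡ; *-congʳ; commutativeSemiring)
  open SetoidReasoning setoid

  extract : ∀ v us w → All (_∈ v ∷ us) w →
    ∃[ k ] ∃[ w′ ] All (_∈ us) w′ Product.× k ℕ.+ length w′ ≡ length w Product.× word w ≈ (var v ^ k) * word w′
  extract v us [] [] = 0 , [] , [] , ≡.refl , ≈-sym (*-identityˡ _)
  extract v us (u ∷ w) (u∈ ∷ w∈) with extract v us w w∈ | u∈
  ... | k , w′ , w′∈ , len , eq | here ≡.refl = suc k , w′ , w′∈ , ≡.cong suc len ,
    ≈-trans (*-congˡ eq) (≈-sym (*-assoc _ _ _))
  ... | k , w′ , w′∈ , len , eq | there u∈us = k , u ∷ w′ , u∈us ∷ w′∈ ,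
    ≡.trans (ℕₚ.+-suc k (length w′)) (≡.cong suc len) ,
    ≈-trans (*-congˡ eq) (x∙yz≈y∙xz _ _ _)
    where
    open CommutativeSemigroupProperties (CommutativeRing.*-commutativeSemigroup (polynomialRing V)) using (x∙yz≈y∙xz)

  -- Pigeonhole: a word of length at least N + D contains v at least N times, or leaves at least D
  -- letters after all v are removed.
  longWords : ∀ us → ∃[ D ] ∀ w → All (_∈ us) w → D ≤ length w → Ideal (word w)
  -- Only the empty word has no letters, so the bound 1 makes the claim vacuous.
  longWords [] = 1 , λ { [] _ () ; (v ∷ w) (() ∷ _) _ }
  longWords (v ∷ us) with N , vᴺ∈I ← nilpotent v | D , h ← longWords us = N ℕ.+ D , long
    where
    long : ∀ w → All (_∈ v ∷ us) w → N ℕ.+ D ≤ length w → Ideal (word w)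
    long w w∈ ≤w with k , w′ , w′∈ , len , eq ← extract v us w w∈ | ℕₚ.≤-total N k
    ... | inj₁ N≤k = respᴵ (≈-sym (begin
      word w                                      ≈⟨ eq ⟩
      (var v ^ k) * word w′                       ≡⟨ ≡.cong (λ i → (var v ^ i) * word w′) (ℕₚ.m∸n+n≡m N≤k) ⟨
      (var v ^ (k ℕ.∸ N ℕ.+ N)) * word w′         ≈⟨ *-congʳ (^-homo-* (var v) (k ℕ.∸ N) N) ⟩
      (var v ^ (k ℕ.∸ N)) * (var v ^ N) * word w′ ≈⟨ *-comm _ _ ⟩
      word w′ * ((var v ^ (k ℕ.∸ N)) * (var v ^ N)) ∎)) (scaleᴵ (word w′) (scaleᴵ (var v ^ (k ℕ.∸ N)) vᴺ∈I))
      where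
      open Exp commutativeSemiring using (^-homo-*)
    ... | inj₂ k≤N = respᴵ (≈-sym eq) (scaleᴵ (var v ^ k) (h w′ w′∈
      (ℕₚ.+-cancelˡ-≤ k _ _ (ℕₚ.≤-trans (ℕₚ.+-monoˡ-≤ D k≤N) (ℕₚ.≤-trans ≤w (ℕₚ.≤-reflexive (≡.sym len)))))))

  private
    D : ℕ
    D = proj₁ (longWords vs)

  words : ℕ → List (List V)
  words zero    = [] ∷ []
  words (suc d) = List.concatMap (λ v → List.map (v ∷_) (words d)) vs

  ∈-words : ∀ w → w ∈ words (length w)
  ∈-words []      = here ≡.refl
  ∈-words (v ∷ w) = ∈-concatMap⁺ (λ v → List.map (v ∷_) (words (length w)))
    (Any.map (λ { ≡.refl → ∈-map⁺ (v ∷_) (∈-words w) }) (∈vs v))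

  generators : List (Polynomial V)
  generators = List.map word (List.concatMap words (List.upTo D))

  private
    M : Polynomial V → Set _
    M p = p ∈Module generators

  shortWords : ∀ w → length w < D → M (word w)
  shortWords w w<D = generatorᴹ (∈-map⁺ word (∈-concatMap⁺ words (Any.map (λ { ≡.refl → ∈-words w }) (∈-upTo⁺ w<D))))

  spanᴹ : ∀ {P p} → (∀ w → P w → M (word w)) → Span P p → M p
  spanᴹ h zeroˢ          = zeroᴹ
  spanᴹ h (termˢ a w Pw) = scaleᴹ (con∈R[θ] a) (h w Pw)
  spanᴹ h (addˢ p q)     = addᴹ (spanᴹ h p) (spanᴹ h q)
  spanᴹ h (respˢ p≈q p)  = respᴹ p≈q (spanᴹ h p)

  -- The product with t in degree e is t times the entry of `b` that lies e places lower, or zero if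
  -- there is none.
  at-⊛ᴹ : ∀ e {t} → t ∈R[ θ ] → ∀ b n → (∀ i → i ℕ.+ e ≤ n → M (b i)) → M ((at e t ⊛ b) n)
  at-⊛ᴹ zero    t∈ b n       h = respᴹ (≈-sym (at-zero-⊛ _ b n)) (scaleᴹ t∈ (h n (ℕₚ.≤-reflexive (ℕₚ.+-identityʳ n))))
  at-⊛ᴹ (suc e) t∈ b zero    h = respᴹ (≈-sym (CommutativeRing.zeroˡ (polynomialRing V) _)) zeroᴹ
  at-⊛ᴹ (suc e) t∈ b (suc n) h = respᴹ (≈-sym (at-suc-⊛ e _ b n))
    (at-⊛ᴹ e t∈ b n λ i i+e≤n → h i (ℕₚ.≤-trans (ℕₚ.≤-reflexive (ℕₚ.+-suc i e)) (s≤s i+e≤n)))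

  -- A component of degree d of an element Σ cₜ t of the ideal only involves
  -- components of the cₜ of degree less than d.
  idealᴹ : ∀ d {p} → (∀ w → length w < d → M (word w)) → Ideal p → M (component p d)
  idealᴹ d h zeroᴵ = respᴹ (≈-sym (at-zero 0 d)) zeroᴹ
  idealᴹ d h (addᴵ p∈I q∈I) = addᴹ (idealᴹ d h p∈I) (idealᴹ d h q∈I)
  idealᴹ d h (respᴵ p≈q p∈I) = respᴹ (component-cong p≈q d) (idealᴹ d h p∈I)
  idealᴹ d h (multᴵ {t} a t∈θ) with e , t-span ← positiveDegree t∈θ = respᴹ (≈-sym (≈-trans
      (⊛-comm (component a) (component t) d) (⊛-cong (component-at t-span) (λ _ → ≈-refl) d)))
    (at-⊛ᴹ (suc e) (θ∈R[θ] t∈θ) (component a) d λ i i+1+e≤d →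
      spanᴹ (λ { w ≡.refl → h w (ℕₚ.≤-trans (s≤s (ℕₚ.m≤m+n i e)) (ℕₚ.≤-trans (ℕₚ.≤-reflexive (≡.sym (ℕₚ.+-suc i e))) i+1+e≤d)) })
        (component-spanned a i))

  -- Strong induction on the length: a short word is a generator; a long one lies in the ideal and
  -- is its own component in degree `length w`, so `idealᴹ` reduces it to shorter words.
  wordᴹ : ∀ d w → length w ≡ d → M (word w)
  wordᴹ = <-rec (λ d → ∀ w → length w ≡ d → M (word w)) step
    where
    step : ∀ d → (∀ {e} → e < d → ∀ w → length w ≡ e → M (word w)) → ∀ w → length w ≡ d → M (word w)
    step d rec w ≡.refl with length w ℕₚ.<? D
    ... | yes w<D = shortWords w w<D
    ... | no  w≮D = respᴹ (≈-trans (component-word w (length w)) (at-refl (length w) (word w)))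
      (idealᴹ (length w) (λ u u<w → rec u<w u ≡.refl)
        (proj₂ (longWords vs) w (All.universal ∈vs w) (ℕₚ.≮⇒≥ w≮D)))

  generated : ∀ p → M p
  generated p = spanᴹ (λ w _ → wordᴹ (length w) w ≡.refl) (spanned p)

-- Sums over the symmetric group.

module PermutationSum {c ℓ} (R : CommutativeRing c ℓ) where

  open CommutativeRing R hiding (zero)
  open SemiringSum semiring
  open Mult +-commutativeMonoid using () renaming (_×_ to _·_; ×-assocˡ to ·-assocˡ)
  open SetoidReasoning setoid

  -- A permutation is given by the image i of 0 and a permutation of the remaining points, so the
  -- sum is a nested one without a list of permutations.
  permutationSum : ∀ n → (Permutation′ n → Carrier) → Carrier
  permutationSum zero    F = F Perm.id
  permutationSum (suc n) F = sum λ i → permutationSum n λ π → F (insert 0F i π)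

  permutationSum-cong : ∀ n {F G} → (∀ π → F π ≈ G π) → permutationSum n F ≈ permutationSum n G
  permutationSum-cong zero    h = h Perm.id
  permutationSum-cong (suc n) h = sum-cong-≋ λ i → permutationSum-cong n λ π → h (insert 0F i π)

  permutationSum-const : ∀ n x → permutationSum n (const x) ≈ (n !) · x
  permutationSum-const zero    x = sym (+-identityʳ x)
  permutationSum-const (suc n) x = begin
    sum {suc n} (λ _ → permutationSum n (const x)) ≈⟨ sum-cong-≋ {suc n} (λ _ → permutationSum-const n x) ⟩
    sum {suc n} (λ _ → (n !) · x)                  ≈⟨ sum-replicate (suc n) ⟩
    suc n · ((n !) · x)                            ≈⟨ ·-assocˡ x (suc n) (n !) ⟩
    (suc n !) · x                                  ∎

  permutationSum-sum : ∀ n {m} (a : Fin m → Carrier) (F : Fin m → Permutation′ n → Carrier) →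
    permutationSum n (λ π → sum λ k → a k * F k π) ≈ sum λ k → a k * permutationSum n (F k)
  permutationSum-sum zero    a F = refl
  permutationSum-sum (suc n) a F = begin
    sum (λ i → permutationSum n λ π → sum λ k → a k * F k (insert 0F i π))
      ≈⟨ sum-cong-≋ (λ i → permutationSum-sum n a λ k π → F k (insert 0F i π)) ⟩
    sum (λ i → sum λ k → a k * permutationSum n λ π → F k (insert 0F i π))
      ≈⟨ ∑-comm (λ i k → a k * permutationSum n λ π → F k (insert 0F i π)) ⟩
    sum (λ k → sum λ i → a k * permutationSum n λ π → F k (insert 0F i π))
      ≈⟨ sum-cong-≋ (λ k → *-distribˡ-sum (a k) λ i → permutationSum n λ π → F k (insert 0F i π)) ⟨
    sum (λ k → a k * sum λ i → permutationSum n λ π → F k (insert 0F i π)) ∎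

  -- Permutations with the same values need not be propositionally equal, so reindexing requires a
  -- summand that depends on the values only.
  Extensional : ∀ {n} → (Permutation′ n → Carrier) → Set ℓ
  Extensional F = ∀ π ρ → π Perm.≈ ρ → F π ≈ F ρ

  insert-cong : ∀ {n} i (π ρ : Permutation′ n) → π Perm.≈ ρ → insert 0F i π Perm.≈ insert 0F i ρ
  insert-cong i π ρ h zero    = ≡.refl
  insert-cong i π ρ h (suc k) = ≡.trans (insert-punchIn 0F i π k)
    (≡.trans (≡.cong (Fin.punchIn i) (h k)) (≡.sym (insert-punchIn 0F i ρ k)))

  insert-∘ₚ : ∀ {n} i (π : Permutation′ n) (σ : Permutation′ (suc n)) →
    insert 0F i π ∘ₚ σ Perm.≈ insert 0F (σ ⟨$⟩ʳ i) (π ∘ₚ remove i σ)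
  insert-∘ₚ i π σ zero    = ≡.refl
  insert-∘ₚ i π σ (suc k) = ≡.trans (≡.cong (σ ⟨$⟩ʳ_) (insert-punchIn 0F i π k))
    (≡.trans (punchIn-permute σ i (π ⟨$⟩ʳ k)) (≡.sym (insert-punchIn 0F (σ ⟨$⟩ʳ i) (π ∘ₚ remove i σ) k)))

  -- Composing with σ carries the permutations with 0 ↦ i to those with 0 ↦ σ i and acts on the rest
  -- by `remove i σ`. Induction handles the rest, and permuting the outer summands by σ finishes.
  permutationSum-∘ₚ : ∀ n {F} → Extensional F → ∀ σ → permutationSum n (λ π → F (π ∘ₚ σ)) ≈ permutationSum n F
  permutationSum-∘ₚ zero    ext σ = ext _ _ λ ()
  permutationSum-∘ₚ (suc n) {F} ext σ = begin
    sum (λ i → permutationSum n λ π → F (insert 0F i π ∘ₚ σ))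
      ≈⟨ sum-cong-≋ (λ i → permutationSum-cong n λ π → ext (insert 0F i π ∘ₚ σ) (insert 0F (σ ⟨$⟩ʳ i) (π ∘ₚ remove i σ)) (insert-∘ₚ i π σ)) ⟩
    sum (λ i → permutationSum n λ π → F (insert 0F (σ ⟨$⟩ʳ i) (π ∘ₚ remove i σ)))
      ≈⟨ sum-cong-≋ (λ i → permutationSum-∘ₚ n {λ π → F (insert 0F (σ ⟨$⟩ʳ i) π)} (λ π ρ h → ext (insert 0F (σ ⟨$⟩ʳ i) π) (insert 0F (σ ⟨$⟩ʳ i) ρ) (insert-cong (σ ⟨$⟩ʳ i) π ρ h)) (remove i σ)) ⟩
    sum (λ i → permutationSum n λ π → F (insert 0F (σ ⟨$⟩ʳ i) π))
      ≈⟨ sum-permute (λ i → permutationSum n λ π → F (insert 0F i π)) σ ⟨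
    sum (λ i → permutationSum n λ π → F (insert 0F i π)) ∎

-- Unordered pairs and evaluation homomorphisms.

⟅⟆-cong : ∀ {n} {i i′ j j′ : Fin n} → i ≡ i′ → j ≡ j′ →
  (p : i ≢ j) (q : i′ ≢ j′) → ⟅ i , j ⟆ p ≡ ⟅ i′ , j′ ⟆ q
⟅⟆-cong {i = i} {j = j} ≡.refl ≡.refl p q with <-cmp i j
... | tri< _ _ _   = ≡.refl
... | tri≈ _ i≡j _ = contradiction i≡j p
... | tri> _ _ _   = ≡.refl

⟅⟆-< : ∀ {n} {i j : Fin n} (i<j : i Fin.< j) (p : i ≢ j) → ⟅ i , j ⟆ p ≡ mkPair i j i<j
⟅⟆-< {i = i} {j} i<j p with <-cmp i j
... | tri< _ _ _   = ≡.refl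
... | tri≈ _ i≡j _ = contradiction i≡j p
... | tri> i≮j _ _ = contradiction i<j i≮j

⟅⟆-> : ∀ {n} {i j : Fin n} (j<i : j Fin.< i) (p : i ≢ j) → ⟅ i , j ⟆ p ≡ mkPair j i j<i
⟅⟆-> {i = i} {j} j<i p with <-cmp i j
... | tri< _ _ j≮i = contradiction j<i j≮i
... | tri≈ _ i≡j _ = contradiction i≡j p
... | tri> _ _ _   = ≡.refl

⟅⟆-swap : ∀ {n} {i j : Fin n} (p : i ≢ j) (q : j ≢ i) → ⟅ i , j ⟆ p ≡ ⟅ j , i ⟆ q
⟅⟆-swap {i = i} {j} p q with <-cmp i j
... | tri< i<j _ _ = ≡.sym (⟅⟆-> i<j q)
... | tri≈ _ i≡j _ = contradiction i≡j p
... | tri> _ _ j<i = ≡.sym (⟅⟆-< j<i q)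

module Evaluation {c ℓ} (R : CommutativeRing c ℓ) where

  open Polynomials R

  private
    variable
      V W : Set

  eval-cong : ∀ (ρ : V → Polynomial W) {p q} → p ≈ q → eval ρ p ≈ eval ρ q
  eval-cong ρ ≈-refl = ≈-refl
  eval-cong ρ (≈-sym h) = ≈-sym (eval-cong ρ h)
  eval-cong ρ (≈-trans h g) = ≈-trans (eval-cong ρ h) (eval-cong ρ g)
  eval-cong ρ (+-cong h g) = +-cong (eval-cong ρ h) (eval-cong ρ g)
  eval-cong ρ (*-cong h g) = *-cong (eval-cong ρ h) (eval-cong ρ g)
  eval-cong ρ (neg-cong h) = neg-cong (eval-cong ρ h)
  eval-cong ρ (+-assoc p q r) = +-assoc _ _ _
  eval-cong ρ (+-comm p q) = +-comm _ _
  eval-cong ρ (+-identityˡ p) = +-identityˡ _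
  eval-cong ρ (+-inverseˡ p) = +-inverseˡ _
  eval-cong ρ (*-assoc p q r) = *-assoc _ _ _
  eval-cong ρ (*-comm p q) = *-comm _ _
  eval-cong ρ (*-identityˡ p) = *-identityˡ _
  eval-cong ρ (distribˡ p q r) = distribˡ _ _ _
  eval-cong ρ (con-cong h) = con-cong h
  eval-cong ρ (con-+ a b) = con-+ a b
  eval-cong ρ (con-* a b) = con-* a b

  eval-sum : ∀ (ρ : V → Polynomial W) {m} (f : Fin m → Polynomial V) → eval ρ (sum f) ≡ sum (eval ρ ∘ f)
  eval-sum ρ {zero}  f = ≡.refl
  eval-sum ρ {suc m} f = ≡.cong (eval ρ (f zero) +_) (eval-sum ρ (f ∘ suc))

  eval-^ : ∀ (ρ : V → Polynomial W) p k → eval ρ (p ^ k) ≡ eval ρ p ^ k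
  eval-^ ρ p zero    = ≡.refl
  eval-^ ρ p (suc k) = ≡.cong (eval ρ p *_) (eval-^ ρ p k)

  eval-ext : ∀ {ρ ρ′ : V → Polynomial W} → (∀ v → ρ v ≡ ρ′ v) → ∀ p → eval ρ p ≡ eval ρ′ p
  eval-ext h (con a) = ≡.refl
  eval-ext h (var v) = h v
  eval-ext h (p + q) = ≡.cong₂ _+_ (eval-ext h p) (eval-ext h q)
  eval-ext h (p * q) = ≡.cong₂ _*_ (eval-ext h p) (eval-ext h q)
  eval-ext h (- p)   = ≡.cong -_ (eval-ext h p)

  eval-eval : ∀ {U : Set} (ρ : V → Polynomial W) (τ : U → Polynomial V) p → eval ρ (eval τ p) ≡ eval (eval ρ ∘ τ) p
  eval-eval ρ τ (con a) = ≡.refl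
  eval-eval ρ τ (var v) = ≡.refl
  eval-eval ρ τ (p + q) = ≡.cong₂ _+_ (eval-eval ρ τ p) (eval-eval ρ τ q)
  eval-eval ρ τ (p * q) = ≡.cong₂ _*_ (eval-eval ρ τ p) (eval-eval ρ τ q)
  eval-eval ρ τ (- p)   = ≡.cong -_ (eval-eval ρ τ p)

-- Invariants and averaging.

module Invariants {c ℓ₁ ℓ₂} (K : HeytingField c ℓ₁ ℓ₂) (char0 : CharacteristicZero K) (n : ℕ) where

  open Polynomials (fieldRing K)
  open GraphInvariants K n
  open Evaluation (fieldRing K)
  open PermutationSum (polynomialRing (Pair n))
  private module K = CommutativeRing (fieldRing K)
  open CommutativeRing (polynomialRing (Pair n)) using (setoid; semiring; reflexive; *-congˡ; *-congʳ; +-congˡ)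
  open SemiringSum semiring using (sum-cong-≋)
  open SetoidReasoning setoid
  open SemiringMult semiring using (×-assoc-*) renaming (_×_ to _·_; ×-congʳ to ·-congʳ)

  divide : ∀ d → ∃[ u ] ∀ p → con u * (suc d · p) ≈ p
  divide d with u , ux≈1 , _ ← HeytingField.#⇒invertible K (char0 d) = u , λ p → begin
    con u * (suc d · p)          ≈⟨ *-congˡ (·-congʳ (suc d) (*-identityˡ p)) ⟨
    con u * (suc d · (1ₚ * p))   ≈⟨ *-congˡ (×-assoc-* (suc d) 1ₚ p) ⟨
    con u * ((suc d · 1ₚ) * p)   ≈⟨ *-assoc _ _ _ ⟨
    con u * (suc d · 1ₚ) * p     ≈⟨ *-congʳ (*-congˡ (con-· (suc d))) ⟨
    con u * con x * p            ≈⟨ *-congʳ (con-* u x) ⟨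
    -- Apartness from 0 is given as invertibility of the difference x - 0.
    con (u K.* x) * p            ≈⟨ *-congʳ (con-cong (K.*-congˡ (K.trans (K.+-congˡ -0#≈0#) (K.+-identityʳ x)))) ⟨
    con (u K.* (x K.- K.0#)) * p ≈⟨ *-congʳ (con-cong ux≈1) ⟩
    1ₚ * p                       ≈⟨ *-identityˡ p ⟩
    p                            ∎
    where
    open RingProperties K.ring using (-0#≈0#)
    open SemiringMult K.semiring using () renaming (_×_ to _×ₖ_)
    x = suc d ×ₖ K.1#
    con-· : ∀ k → con (k ×ₖ K.1#) ≈ k · 1ₚ
    con-· zero    = ≈-refl
    con-· (suc k) = ≈-trans (con-+ _ _) (+-congˡ (con-· k))

  divide-n! : ∃[ u ] ∀ p → con u * ((n !) · p) ≈ p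
  divide-n! with u , eq ← divide (ℕ.pred (n !)) =
    u , λ p → ≈-trans (reflexive (≡.cong (λ k → con u * (k · p)) (≡.sym (ℕₚ.suc-pred (n !) {{n ℕₚ.!≢0}})))) (eq p)

  ∙ₑ-⟅⟆ : ∀ σ {i j} (p : i ≢ j) (q : σ ⟨$⟩ʳ i ≢ σ ⟨$⟩ʳ j) → σ ∙ₑ ⟅ i , j ⟆ p ≡ ⟅ σ ⟨$⟩ʳ i , σ ⟨$⟩ʳ j ⟆ q
  ∙ₑ-⟅⟆ σ {i} {j} p q with <-cmp i j
  ... | tri< _ _ _   = ⟅⟆-cong ≡.refl ≡.refl _ q
  ... | tri≈ _ i≡j _ = contradiction i≡j p
  ... | tri> _ _ _   = ⟅⟆-swap _ q

  ∙ₑ-∘ₚ : ∀ σ τ e → σ ∙ₑ τ ∙ₑ e ≡ (τ ∘ₚ σ) ∙ₑ e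
  ∙ₑ-∘ₚ σ τ (mkPair i j i<j) = ∙ₑ-⟅⟆ σ _ _

  ∙ₑ-cong : ∀ σ τ → σ Perm.≈ τ → ∀ e → σ ∙ₑ e ≡ τ ∙ₑ e
  ∙ₑ-cong σ τ σ≈τ (mkPair i j i<j) = ⟅⟆-cong (σ≈τ i) (σ≈τ j) _ _

  ∙-∘ₚ : ∀ σ τ p → σ ∙ τ ∙ p ≡ (τ ∘ₚ σ) ∙ p
  ∙-∘ₚ σ τ p = ≡.trans (eval-eval _ _ p) (eval-ext (λ e → ≡.cong var (∙ₑ-∘ₚ σ τ e)) p)

  -- This is n! times the Reynolds operator.
  orbitSum : Polynomial (Pair n) → Polynomial (Pair n)
  orbitSum p = permutationSum n λ σ → σ ∙ p

  orbitSum-invariant : ∀ p → Invariant (orbitSum p)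
  orbitSum-invariant p τ = begin
    τ ∙ orbitSum p                        ≡⟨ ∙-permutationSum n (λ σ → σ ∙ p) ⟩
    permutationSum n (λ σ → τ ∙ σ ∙ p)    ≈⟨ permutationSum-cong n (λ σ → reflexive (∙-∘ₚ τ σ p)) ⟩
    permutationSum n (λ σ → (σ ∘ₚ τ) ∙ p) ≈⟨ permutationSum-∘ₚ n (λ σ ρ h → reflexive (eval-ext (λ e → ≡.cong var (∙ₑ-cong σ ρ h e)) p)) τ ⟩
    orbitSum p                            ∎
    where
    ∙-permutationSum : ∀ m F → τ ∙ permutationSum m F ≡ permutationSum m λ σ → τ ∙ F σ
    ∙-permutationSum zero    F = ≡.refl
    ∙-permutationSum (suc m) F = ≡.trans (eval-sum _ λ i → permutationSum m λ π → F (insert 0F i π))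
      (sum-cong-≗ λ i → ∙-permutationSum m λ π → F (insert 0F i π))
      where
      open SemiringSum semiring using (sum-cong-≗)

  module _ {θ : List (Polynomial (Pair n))} (θ-invariant : All Invariant θ) where

    open Combinations (fieldRing K) (Pair n) θ

    R[θ]-invariant : ∀ {a} → a ∈R[ θ ] → Invariant a
    R[θ]-invariant (P , a≈) σ = ≈-trans (eval-cong _ a≈) (≈-trans (go P) (≈-sym a≈))
      where
      go : ∀ P → σ ∙ eval (lookup θ) P ≈ eval (lookup θ) P
      go (con a) = ≈-refl
      go (var k) = All.lookup θ-invariant (∈-lookup k) σ
      go (P + Q) = +-cong (go P) (go Q)
      go (P * Q) = *-cong (go P) (go Q)
      go (- P)   = neg-cong (go P)

    -- The Reynolds operator is linear over the subalgebra of invariants K[θ].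
    reynolds : ∀ gs → (∀ p → p ∈Module gs) → FinitelyGeneratedOver θ
    reynolds gs generated = List.map orbitSum gs , AllP.map⁺ (All.universal orbitSum-invariant gs) ,
      λ f f-inv → let combination a a∈ eq = f∈ f f-inv in a , a∈ , eq
      where
      f∈ : ∀ f → Invariant f → f ∈Module List.map orbitSum gs
      f∈ f f-inv with combination a a∈ eq ← generated f =
        respᴹ (begin
          con u * sum (λ k → a k * orbitSum (lookup gs k))                    ≈⟨ *-congˡ (permutationSum-sum n a λ k σ → σ ∙ lookup gs k) ⟨
          con u * permutationSum n (λ σ → sum λ k → a k * σ ∙ lookup gs k)    ≈⟨ *-congˡ (permutationSum-cong n fixed) ⟨
          con u * permutationSum n (const f)                                  ≈⟨ *-congˡ (permutationSum-const n f) ⟩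
          con u * ((n !) · f)                                                 ≈⟨ proj₂ divide-n! f ⟩
          f                                                                   ∎)
        (scaleᴹ (con∈R[θ] u) (sumᴹ λ k → scaleᴹ (a∈ k) (generatorᴹ (∈-map⁺ orbitSum (∈-lookup k)))))
        where
        u = proj₁ divide-n!
        fixed : ∀ σ → f ≈ sum λ k → a k * σ ∙ lookup gs k
        fixed σ = begin
          f                                           ≈⟨ f-inv σ ⟨
          σ ∙ f                                       ≈⟨ eval-cong _ eq ⟩
          σ ∙ sum (λ k → a k * lookup gs k)           ≡⟨ eval-sum _ (λ k → a k * lookup gs k) ⟩
          sum (λ k → σ ∙ a k * σ ∙ lookup gs k)       ≈⟨ sum-cong-≋ (λ k → *-congʳ (R[θ]-invariant (a∈ k) σ)) ⟩
          sum (λ k → a k * σ ∙ lookup gs k)           ∎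
        sumᴹ : ∀ {m} {f : Fin m → Polynomial (Pair n)} → (∀ k → f k ∈Module List.map orbitSum gs) → sum f ∈Module List.map orbitSum gs
        sumᴹ {zero}  h = zeroᴹ
        sumᴹ {suc m} h = addᴹ (h zero) (sumᴹ (h ∘ suc))

-- The parameters: invariance, degrees, and their vanishing in the quotient.

module Parameters {c ℓ₁ ℓ₂} (K : HeytingField c ℓ₁ ℓ₂) (char0 : CharacteristicZero K) (n : ℕ) where

  open Polynomials (fieldRing K)
  open GraphInvariants K n
  open Evaluation (fieldRing K)
  open Invariants K char0 n
  open CommutativeRing (polynomialRing (Pair n)) using (setoid; semiring; reflexive; *-congˡ; +-identityʳ; +-congˡ)
  open SemiringSum semiring using (sum-cong-≋; sum-permute; ∑-distrib-+; ∑-comm; sum-cong-≗)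
  open SemiringMult semiring using () renaming (_×_ to _·_)
  open Grading (fieldRing K) (Pair n)
  open SetoidReasoning setoid

  ordered : ℕ → Fin n → Fin n → Polynomial (Pair n)
  ordered k i j = when (i <? j) λ i<j → var (mkPair i j i<j) ^ k

  unordered : ℕ → Fin n → Fin n → Polynomial (Pair n)
  unordered k i j = when (¬? (i ≟ j)) λ i≢j → var (⟅ i , j ⟆ i≢j) ^ k

  unordered≈ : ∀ k i j → unordered k i j ≈ ordered k i j + ordered k j i
  unordered≈ k i j with i ≟ j | i <? j | j <? i
  ... | yes ≡.refl | yes i<i | _       = contradiction i<i (<-irrefl ≡.refl)
  ... | yes ≡.refl | no _    | yes i<i = contradiction i<i (<-irrefl ≡.refl)
  ... | yes ≡.refl | no _    | no _    = ≈-sym (+-identityʳ _)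
  ... | no i≢j     | yes i<j | yes j<i = contradiction j<i (<-asym i<j)
  ... | no i≢j     | yes i<j | no _    = ≈-sym (≈-trans (+-identityʳ _)
    (reflexive (≡.cong (λ e → var e ^ k) (≡.sym (⟅⟆-< i<j i≢j)))))
  ... | no i≢j     | no _    | yes j<i = ≈-sym (≈-trans (+-identityˡ _)
    (reflexive (≡.cong (λ e → var e ^ k) (≡.sym (⟅⟆-> j<i i≢j)))))
  ... | no i≢j     | no i≮j  | no j≮i with <-cmp i j
  ... | tri< i<j _ _ = contradiction i<j i≮j
  ... | tri≈ _ i≡j _ = contradiction i≡j i≢j
  ... | tri> _ _ j<i = contradiction j<i j≮i

  ∙-unordered : ∀ σ k i j → σ ∙ unordered k i j ≡ unordered k (σ ⟨$⟩ʳ i) (σ ⟨$⟩ʳ j)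
  ∙-unordered σ k i j with i ≟ j | (σ ⟨$⟩ʳ i) ≟ (σ ⟨$⟩ʳ j)
  ... | yes _   | yes _     = ≡.refl
  ... | yes i≡j | no  σi≢σj = contradiction (≡.cong (σ ⟨$⟩ʳ_) i≡j) σi≢σj
  ... | no  i≢j | yes σi≡σj = contradiction (Injection.injective (↔⇒↣ σ) σi≡σj) i≢j
  ... | no  i≢j | no  σi≢σj = ≡.trans (eval-^ _ _ k) (≡.cong (λ e → var e ^ k) (∙ₑ-⟅⟆ σ i≢j σi≢σj))

  ∙-unorderedSum : ∀ σ k i → σ ∙ sum (unordered k i) ≈ sum (unordered k (σ ⟨$⟩ʳ i))
  ∙-unorderedSum σ k i = begin
    σ ∙ sum (unordered k i)                       ≡⟨ eval-sum _ (unordered k i) ⟩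
    sum (λ j → σ ∙ unordered k i j)               ≈⟨ sum-cong-≋ (λ j → reflexive (∙-unordered σ k i j)) ⟩
    sum (λ j → unordered k (σ ⟨$⟩ʳ i) (σ ⟨$⟩ʳ j)) ≈⟨ sum-permute (unordered k (σ ⟨$⟩ʳ i)) σ ⟨
    sum (unordered k (σ ⟨$⟩ʳ i))                  ∎

  doubled : ∀ k → 2 · pairPowerSum k ≈ sum λ i → sum λ j → unordered k i j
  doubled k = ≈-sym (begin
    sum (λ i → sum λ j → unordered k i j)
      ≈⟨ sum-cong-≋ (λ i → sum-cong-≋ λ j → unordered≈ k i j) ⟩
    sum (λ i → sum λ j → ordered k i j + ordered k j i)
      ≈⟨ sum-cong-≋ (λ i → ∑-distrib-+ (ordered k i) (λ j → ordered k j i)) ⟩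
    sum (λ i → sum (λ j → ordered k i j) + sum (λ j → ordered k j i))
      ≈⟨ ∑-distrib-+ (λ i → sum λ j → ordered k i j) (λ i → sum λ j → ordered k j i) ⟩
    pairPowerSum k + sum (λ i → sum λ j → ordered k j i)
      ≈⟨ +-congˡ (∑-comm λ i j → ordered k j i) ⟩
    pairPowerSum k + pairPowerSum k
      ≈⟨ +-congˡ (+-identityʳ _) ⟨
    2 · pairPowerSum k ∎)

  -- Permutations do not preserve i < j, but they preserve i ≠ j. So the invariance is proved for
  -- twice the sum, taken over all ordered pairs of distinct vertices, and then halved.
  pairPowerSum-invariant : ∀ k → Invariant (pairPowerSum k)
  pairPowerSum-invariant k σ with u , halve ← divide 1 = begin
    σ ∙ pairPowerSum k                                    ≈⟨ eval-cong _ (halve (pairPowerSum k)) ⟨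
    con u * σ ∙ (2 · pairPowerSum k)                      ≈⟨ *-congˡ (eval-cong _ (doubled k)) ⟩
    con u * σ ∙ sum (λ i → sum (unordered k i))           ≡⟨ ≡.cong (con u *_) (eval-sum _ λ i → sum (unordered k i)) ⟩
    con u * sum (λ i → σ ∙ sum (unordered k i))           ≈⟨ *-congˡ (sum-cong-≋ λ i → ∙-unorderedSum σ k i) ⟩
    con u * sum (λ i → sum (unordered k (σ ⟨$⟩ʳ i)))      ≈⟨ *-congˡ (sum-permute (λ i → sum (unordered k i)) σ) ⟨
    con u * sum (λ i → sum (unordered k i))               ≈⟨ *-congˡ (doubled k) ⟨
    con u * (2 · pairPowerSum k)                          ≈⟨ halve (pairPowerSum k) ⟩
    pairPowerSum k                                        ∎

  X≈unorderedSum : ∀ i → X i ≈ sum (unordered 1 i)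
  X≈unorderedSum i = sum-cong-≋ λ j → go (i ≟ j)
    where
    go : ∀ {j} (d : Dec (i ≡ j)) → when (¬? d) (λ i≢j → var (⟅ i , j ⟆ i≢j)) ≈ when (¬? d) (λ i≢j → var (⟅ i , j ⟆ i≢j) ^ 1)
    go (yes _) = ≈-refl
    go (no _)  = ≈-sym (CommutativeRing.*-identityʳ (polynomialRing (Pair n)) _)

  vertexPowerSum-invariant : ∀ k → Invariant (vertexPowerSum k)
  vertexPowerSum-invariant k σ = begin
    σ ∙ vertexPowerSum k           ≡⟨ eval-sum _ (λ i → X i ^ k) ⟩
    sum (λ i → σ ∙ (X i ^ k))      ≈⟨ sum-cong-≋ (λ i → ≈-trans (reflexive (eval-^ _ (X i) k)) (^-congˡ k (∙-X i))) ⟩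
    sum (λ i → X (σ ⟨$⟩ʳ i) ^ k)   ≈⟨ sum-permute (λ i → X i ^ k) σ ⟨
    vertexPowerSum k               ∎
    where
    open Exp (CommutativeRing.commutativeSemiring (polynomialRing (Pair n))) using (^-congˡ)
    ∙-X : ∀ i → σ ∙ X i ≈ X (σ ⟨$⟩ʳ i)
    ∙-X i = ≈-trans (eval-cong _ (X≈unorderedSum i))
      (≈-trans (∙-unorderedSum σ 1 i) (≈-sym (X≈unorderedSum (σ ⟨$⟩ʳ i))))

  sumˢ : ∀ {P m} (f : Fin m → Polynomial (Pair n)) → (∀ i → Span P (f i)) → Span P (sum f)
  sumˢ {m = zero}  f h = zeroˢ
  sumˢ {m = suc m} f h = addˢ (h zero) (sumˢ (f ∘ suc) (h ∘ suc))

  whenˢ : ∀ {a} {A : Set a} {P} (d : Dec A) {f : A → Polynomial (Pair n)} → (∀ x → Span P (f x)) → Span P (when d f)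
  whenˢ (yes x) h = h x
  whenˢ (no _)  h = zeroˢ

  ^ˢ : ∀ p k → Span (HasLength 1) p → Span (HasLength k) (p ^ k)
  ^ˢ p k h = ≡.subst (λ d → Span (HasLength d) (p ^ k)) (ℕₚ.*-identityʳ k) (^ˢ-length 1 k h)

  pairPowerSumˢ : ∀ k → Span (HasLength k) (pairPowerSum k)
  pairPowerSumˢ k = sumˢ (λ i → sum (ordered k i)) λ i → sumˢ (ordered k i) λ j →
    whenˢ (i <? j) λ i<j → ^ˢ (var (mkPair i j i<j)) k (varˢ (mkPair i j i<j) ≡.refl)

  vertexPowerSumˢ : ∀ k → Span (HasLength k) (vertexPowerSum k)
  vertexPowerSumˢ k = sumˢ (λ i → X i ^ k) λ i → ^ˢ (X i) k (sumˢ _ λ j →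
    whenˢ (¬? (i ≟ j)) λ i≢j → varˢ (⟅ i , j ⟆ i≢j) ≡.refl)

  -- The exponents appear as successors because the Nakayama argument needs positive degrees.
  parameters-all : ∀ {ℓ} (P : Polynomial (Pair n) → Set ℓ) →
    (∀ k → P (pairPowerSum (suc k))) → (∀ k → P (vertexPowerSum (suc k))) → All P parameters
  parameters-all P h g = AllP.++⁺
    (AllP.map⁺ {f = pairPowerSum} (AllP.map⁺ {f = 2 ℕ.+_} (All.universal (h ∘ suc) (List.upTo (suc ((n ℕ.∸ 1) C 2) ℕ.∸ 2)))))
    (AllP.map⁺ {f = vertexPowerSum} (AllP.map⁺ {f = 1 ℕ.+_} (All.universal g (List.upTo n))))

  open Radical (polynomialRing (Pair n)) parameters public

  -- Reduces everything but the count to the nilpotency of each variable modulo the parameters;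
  -- module generators are the orbit sums of short words.
  systemOfParameters : length parameters ≡ n C 2 → (∀ e → var e ~ 0ₚ) → IsSystemOfParameters parameters
  systemOfParameters size var~0 = record
    { size              = size
    ; homogeneous       = All.map (λ (d , h) → suc d , homogeneous h) graded
    ; invariant         = inv
    ; finitelyGenerated = reynolds inv generators generated
    }
    where
    inv : All Invariant parameters
    inv = parameters-all Invariant (pairPowerSum-invariant ∘ suc) (vertexPowerSum-invariant ∘ suc)
    graded : All (λ t → ∃[ d ] Span (HasLength (suc d)) t) parameters
    graded = parameters-all (λ t → ∃[ d ] Span (HasLength (suc d)) t) (λ k → k , pairPowerSumˢ (suc k)) (λ k → k , vertexPowerSumˢ (suc k))
    open GradedNakayama (fieldRing K) (pairs n) ∈-pairs parameters (All.lookup graded) (λ e → ~0⇒Rad (var~0 e))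

  torsionFree : TorsionFree reducedQuotient
  torsionFree = Q-torsionFree λ d → let u , eq = divide d in con u , eq 1ₚ

  parameter~0 : ∀ {t} → t ∈ parameters → t ~ 0ₚ
  parameter~0 {t} t∈ = Rad⇒~0 (Ideal⇒Rad (respᴵ (*-identityˡ t) (multᴵ 1ₚ t∈)))

  open ReducedTorsionFree reducedQuotient torsionFree Q-reduced using (powerSums≈0⇒≈0)
  open EdgeWeights reducedQuotient using (vertexSum; pairSum)

  when-Q : ∀ {a} {A : Set a} (d : Dec A) {f g : A → Polynomial (Pair n)} → (∀ x → f x ≡ g x) →
    EdgeWeights.when reducedQuotient d f ≡ when d g
  when-Q (yes x) h = h x
  when-Q (no _)  h = ≡.refl

  X≡vertexSum : ∀ i → X i ≡ vertexSum var i
  X≡vertexSum i = ≡.sym (≡.trans (Q-sum λ j → EdgeWeights.when reducedQuotient (¬? (i ≟ j)) λ i≢j → var (⟅ i , j ⟆ i≢j))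
    (sum-cong-≗ λ j → when-Q (¬? (i ≟ j)) λ i≢j → ≡.refl {x = var (⟅ i , j ⟆ i≢j)}))

  pairPowerSum≡pairSum : ∀ k → pairPowerSum k ≡ pairSum var k
  pairPowerSum≡pairSum k = ≡.sym (≡.trans (Q-sum λ i → Q.sum (term i))
    (sum-cong-≗ λ i → ≡.trans (Q-sum (term i))
      (sum-cong-≗ λ j → when-Q (i <? j) λ i<j → Q-^ (var (mkPair i j i<j)) k)))
    where
    term : Fin n → Fin n → Polynomial (Pair n)
    term i j = EdgeWeights.when reducedQuotient (i <? j) λ i<j → var (mkPair i j i<j) Q.^ k

  -- Newton's identities for the n elements X_i; the bound on n is that of the certificates.
  vertexSum~0 : n ≤ 5 → ∀ i → vertexSum var i ~ 0ₚ
  vertexSum~0 n≤5 i = ≡.subst (_~ 0ₚ) (X≡vertexSum i) (powerSums≈0⇒≈0 n n≤5 X vertexPowerSum~0 i)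
    where
    vertexPowerSum~0 : ∀ (k : Fin n) → _
    vertexPowerSum~0 k = ≡.subst (_~ 0ₚ) (≡.sym (Q-powerSum X (suc (toℕ k))))
      (parameter~0 (∈-++⁺ʳ _ (∈-map⁺ vertexPowerSum (∈-map⁺ (1 ℕ.+_) (∈-upTo⁺ (toℕ<n k))))))

  -- The exponents 2 to b, with b the binomial coefficient, are b - 1 in number.
  pairSum~0 : ∀ (k : Fin ((n ℕ.∸ 1) C 2 ℕ.∸ 1)) → pairSum var (2 ℕ.+ toℕ k) ~ 0ₚ
  pairSum~0 k = ≡.subst (_~ 0ₚ) (pairPowerSum≡pairSum (2 ℕ.+ toℕ k))
    (parameter~0 (∈-++⁺ˡ (∈-map⁺ pairPowerSum (∈-map⁺ (2 ℕ.+_) (∈-upTo⁺ (toℕ<n k))))))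

-- The cases of three, four and five vertices combined.

proposition4p3 : ∀ {c ℓ₁ ℓ₂} (K : HeytingField c ℓ₁ ℓ₂) → CharacteristicZero K → (n : ℕ) → 3 ≤ n → n ≤ 5 →
    GraphInvariants.IsSystemOfParameters K n (GraphInvariants.parameters K n)
proposition4p3 K char0 1 (s≤s ()) _
proposition4p3 K char0 2 (s≤s (s≤s ())) _
-- The number of parameters is found by computation; for n = 3 the list of edge power sums is empty
-- and the vertex sums alone are used.
proposition4p3 K char0 3 _ n≤5 = systemOfParameters ≡.refl (edgeWeights≈0₃ var (vertexSum~0 n≤5))
  where
  open Polynomials (fieldRing K) using (var)
  open Parameters K char0 3
  open ReducedTorsionFree reducedQuotient torsionFree Q-reduced using (edgeWeights≈0₃)
proposition4p3 K char0 4 _ n≤5 = systemOfParameters ≡.refl (edgeWeights≈0₄ var (vertexSum~0 n≤5) pairSum~0)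
  where
  open Polynomials (fieldRing K) using (var)
  open Parameters K char0 4
  open ReducedTorsionFree reducedQuotient torsionFree Q-reduced using (edgeWeights≈0₄)
proposition4p3 K char0 5 _ n≤5 = systemOfParameters ≡.refl (edgeWeights≈0₅ var (vertexSum~0 n≤5) pairSum~0)
  where
  open Polynomials (fieldRing K) using (var)
  open Parameters K char0 5
  open ReducedTorsionFree reducedQuotient torsionFree Q-reduced using (edgeWeights≈0₅)
proposition4p3 K char0 (suc (suc (suc (suc (suc (suc n)))))) _ (s≤s (s≤s (s≤s (s≤s (s≤s ())))))
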